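{- For each odd prime $p$ there is a Hadamard matrix of order $4+4p^2$ whose excess equals $8p(1+p^2)$, and $8p(1+p^2)$ is the largest excess among all Hadamard matrices equivalent to it.
   Context: A Hadamard matrix of order $n$ is an $n\times n$ matrix $H$ with entries $\pm1$ satisfying $HH^t=nI_n$. The excess of a Hadamard matrix is the sum of all its entries. Two Hadamard matrices $H,K$ are equivalent if $H=PKQ$ for some signed permutation matrices $P,Q$ (permutation matrices whose nonzero entries are $\pm1$). -}

module Defs where

open import Data.Nat using (ℕ; zero; suc)
open import Data.Integer using (ℤ; +_; -_; _+_; _*_; 0ℤ; 1ℤ)
open import Data.Fin using (Fin; zero; suc; _≟_)
open import Relation.Nullary using (yes; no)
open import Data.Fin.Permutation using (Permutation′; _⟨$⟩ʳ_)
open import Data.Sum using (_⊎_)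
open import Data.Product using (_×_; ∃; ∃₂)
open import Relation.Binary.PropositionalEquality using (_≡_; _≢_)

Matrix : ℕ → Set
Matrix n = Fin n → Fin n → ℤ

sumFin : ∀ {n} → (Fin n → ℤ) → ℤ
sumFin {zero}  f = 0ℤ
sumFin {suc n} f = f zero + sumFin (λ i → f (suc i))

_⊗_ : ∀ {n} → Matrix n → Matrix n → Matrix n
(A ⊗ B) i k = sumFin (λ j → A i j * B j k)

_ᵗ : ∀ {n} → Matrix n → Matrix n
(A ᵗ) i j = A j i

scalarId : ∀ {n} → ℤ → Matrix n
scalarId c i j with i ≟ j
... | yes _ = c
... | no  _ = 0ℤ

IsHadamard : ∀ n → Matrix n → Set
IsHadamard n H =
  (∀ i j → H i j ≡ 1ℤ ⊎ H i j ≡ - 1ℤ) ×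
  (∀ i j → (H ⊗ (H ᵗ)) i j ≡ scalarId (+ n) i j)

excess : ∀ {n} → Matrix n → ℤ
excess H = sumFin (λ i → sumFin (λ j → H i j))

IsSignedPerm : ∀ n → Matrix n → Set
IsSignedPerm n P = ∃ λ (σ : Permutation′ n) →
  ∀ i j → (j ≡ σ ⟨$⟩ʳ i → P i j ≡ 1ℤ ⊎ P i j ≡ - 1ℤ) ×
          (j ≢ σ ⟨$⟩ʳ i → P i j ≡ 0ℤ)

Equivalent : ∀ n → Matrix n → Matrix n → Set
Equivalent n H K = ∃₂ λ P Q → IsSignedPerm n P × IsSignedPerm n Q ×
  (∀ i j → H i j ≡ ((P ⊗ K) ⊗ Q) i j)

{-# OPTIONS --safe #-}
-- H is a signing of [[K, K], [K, -K]], where K is the Paley II matrix [[C + I, C - I], [C - I, -C - I]] of order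
-- k = 2(1 + p²) built from a symmetric conference matrix C of order 1 + p² with a sign vector ζ such that C ζ = p ζ.
--
-- Any matrix equivalent to H has excess Σᵢ sᵢ(Aᵢ + Bᵢ) + tᵢ(Aᵢ - Bᵢ) with A = K y, B = K z for sign vectors s, t, y, z;
-- this is at most 4 Σᵢ max(|Pᵢ|, |Qᵢ|), where A = 2P and B = 2Q. As K is Hadamard of order divisible by 4, the parity
-- of Pᵢ does not depend on i, nor does that of Qᵢ, and Σ Aᵢ² = Σ Bᵢ² = k². In each parity case max(|P|, |Q|) is bounded
-- by a quadratic α + β P² + γ Q² on the lattice points of the right parity, and summing over the rows gives exactly
-- 8p(1 + p²). The parities matter: Cauchy-Schwarz alone only gives the larger bound 8(1 + p²)√(1 + p²).
--
-- C is the bordered matrix of AG(2, p) in which a pair of points gets the sign of the direction of its joining line,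
-- with (p + 1)/2 of the p + 1 directions positive; ζ is constant on the lines of a positive direction.
module Submission where

open import Defs

module Construction where

  open import Data.Nat.Base as ℕ using (ℕ; zero; suc)
  import Data.Nat.Properties as ℕₚ
  import Data.Nat.Divisibility as ℕᵈ
  open import Data.Nat.Coprimality using (Coprime; coprime-Bézout)
  open import Data.Nat.GCD using (module Bézout)
  open import Data.Nat.Primality using (Prime; prime; prime⇒nonZero; prime⇒irreducible; euclidsLemma)
  open import Data.Integer.Base using (ℤ; +_; -[1+_]; -_; _+_; _*_; _-_; _≤_; ∣_∣; 0ℤ; 1ℤ; +≤+; Positive)
  import Data.Integer.Properties as ℤₚ
  open import Data.Integer.DivMod using (_%ℕ_; _/ℕ_; n%ℕd<d; a≡a%ℕn+[a/ℕn]*n)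
  open import Data.Integer.Divisibility.Signed
  open import Data.Integer.Tactic.RingSolver using (solve-∀)
  open import Data.Fin.Base using (Fin; zero; suc; toℕ; fromℕ<; combine; remQuot; _↑ˡ_; _↑ʳ_)
  open import Data.Fin.Permutation using (_⟨$⟩ʳ_; _⟨$⟩ˡ_; inverseˡ; inverseʳ)
  open import Data.Fin.Properties using (_≟_; remQuot-combine; combine-remQuot; suc-injective; toℕ-fromℕ<; toℕ<n; toℕ-injective)
  open import Data.Product using (_×_; _,_; proj₁; proj₂; ∃; Σ)
  open import Data.Sum using (_⊎_; inj₁; inj₂)
  open import Function using (_∘_)
  open import Relation.Nullary using (¬_; Dec; yes; no; contradiction)
  open import Relation.Binary.PropositionalEquality

  -- Finite sums

  sum-cong : ∀ {n} {f g : Fin n → ℤ} → (∀ i → f i ≡ g i) → sumFin f ≡ sumFin g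
  sum-cong {zero}  h = refl
  sum-cong {suc n} h = cong₂ _+_ (h zero) (sum-cong (h ∘ suc))

  sum-+ : ∀ {n} (f g : Fin n → ℤ) → sumFin (λ i → f i + g i) ≡ sumFin f + sumFin g
  sum-+ {zero}  f g = refl
  sum-+ {suc n} f g = trans (cong (λ s → f zero + g zero + s) (sum-+ (f ∘ suc) (g ∘ suc))) (interchange (f zero) (g zero) (sumFin (f ∘ suc)) (sumFin (g ∘ suc)))
    where
    interchange : ∀ a b c d → (a + b) + (c + d) ≡ (a + c) + (b + d)
    interchange = solve-∀

  sum-*ˡ : ∀ {n} c (f : Fin n → ℤ) → sumFin (λ i → c * f i) ≡ c * sumFin f
  sum-*ˡ {zero}  c f = sym (ℤₚ.*-zeroʳ c)
  sum-*ˡ {suc n} c f = trans (cong (λ s → c * f zero + s) (sum-*ˡ c (f ∘ suc))) (sym (ℤₚ.*-distribˡ-+ c _ _))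

  sum-*ʳ : ∀ {n} c (f : Fin n → ℤ) → sumFin (λ i → f i * c) ≡ sumFin f * c
  sum-*ʳ c f = trans (sum-cong (λ i → ℤₚ.*-comm (f i) c))
              (trans (sum-*ˡ c f) (ℤₚ.*-comm c (sumFin f)))

  sum-const : ∀ n c → sumFin {n} (λ _ → c) ≡ + n * c
  sum-const zero    c = sym (ℤₚ.*-zeroˡ c)
  sum-const (suc n) c = trans (cong (_+_ c) (sum-const n c)) (sym (ℤₚ.suc-* (+ n) c))

  sum-zero : ∀ {n} {f : Fin n → ℤ} → (∀ i → f i ≡ 0ℤ) → sumFin f ≡ 0ℤ
  sum-zero {n} h = trans (sum-cong h) (trans (sum-const n 0ℤ) (ℤₚ.*-zeroʳ (+ n)))

  sum-swap : ∀ {m n} (f : Fin m → Fin n → ℤ) →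
    sumFin (λ i → sumFin (λ j → f i j)) ≡ sumFin (λ j → sumFin (λ i → f i j))
  sum-swap {zero} {n} f = sym (sum-zero {n} {λ _ → 0ℤ} (λ _ → refl))
  sum-swap {suc m} f = trans (cong (_+_ (sumFin (f zero))) (sum-swap (f ∘ suc)))
                             (sym (sum-+ (f zero) (λ j → sumFin (λ i → f (suc i) j))))

  sum-single : ∀ {n} {f : Fin n → ℤ} i₀ → (∀ j → j ≢ i₀ → f j ≡ 0ℤ) → sumFin f ≡ f i₀
  sum-single {f = f} zero h =
    trans (cong (_+_ (f zero)) (sum-zero (λ j → h (suc j) λ ()))) (ℤₚ.+-identityʳ _)
  sum-single {f = f} (suc i) h =
    trans (cong₂ _+_ (h zero λ ()) (sum-single i (λ j j≢i → h (suc j) (j≢i ∘ suc-injective))))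
          (ℤₚ.+-identityˡ _)

  sum-mono : ∀ {n} {f g : Fin n → ℤ} → (∀ i → f i ≤ g i) → sumFin f ≤ sumFin g
  sum-mono {zero}  h = ℤₚ.≤-refl
  sum-mono {suc n} h = ℤₚ.+-mono-≤ (h zero) (sum-mono (h ∘ suc))

  sum-↑ : ∀ m {n} (f : Fin (m ℕ.+ n) → ℤ) →
    sumFin f ≡ sumFin (λ i → f (i ↑ˡ n)) + sumFin (λ j → f (m ↑ʳ j))
  sum-↑ zero    f = sym (ℤₚ.+-identityˡ _)
  sum-↑ (suc m) f = trans (cong (_+_ (f zero)) (sum-↑ m (f ∘ suc))) (sym (ℤₚ.+-assoc (f zero) _ _))

  sum-combine : ∀ m {n} (f : Fin (m ℕ.* n) → ℤ) →
    sumFin f ≡ sumFin (λ i → sumFin (λ j → f (combine {m} i j)))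
  sum-combine zero        f = refl
  sum-combine (suc m) {n} f = trans (sum-↑ n f) (cong (λ s → sumFin (λ j → f (j ↑ˡ (m ℕ.* n))) + s) (sum-combine m (λ u → f (n ↑ʳ u))))

  sum-remQuot : ∀ m {n} (f : Fin m × Fin n → ℤ) →
    sumFin (λ u → f (remQuot {m} n u)) ≡ sumFin (λ i → sumFin (λ j → f (i , j)))
  sum-remQuot m f = trans (sum-combine m _)
    (sum-cong λ i → sum-cong λ j → cong f (remQuot-combine {m} i j))

  scalarId-refl : ∀ {n} c (i : Fin n) → scalarId c i i ≡ c
  scalarId-refl c i with i ≟ i
  ... | yes _   = refl
  ... | no  i≢i = contradiction refl i≢i

  scalarId-≢ : ∀ {n} c {i j : Fin n} → i ≢ j → scalarId c i j ≡ 0ℤ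
  scalarId-≢ c {i} {j} i≢j with i ≟ j
  ... | yes i≡j = contradiction i≡j i≢j
  ... | no  _   = refl

  sum-scalarId : ∀ {n} c (i : Fin n) (f : Fin n → ℤ) → sumFin (λ j → scalarId c i j * f j) ≡ c * f i
  sum-scalarId c i f = trans
    (sum-single i λ j j≢i → trans (cong (_* f j) (scalarId-≢ c (j≢i ∘ sym))) (ℤₚ.*-zeroˡ (f j)))
    (cong (_* f i) (scalarId-refl c i))

  -- Signs and parity

  IsSign : ℤ → Set
  IsSign x = x ≡ 1ℤ ⊎ x ≡ - 1ℤ

  sign-square : ∀ {x} → IsSign x → x * x ≡ 1ℤ
  sign-square (inj₁ refl) = refl
  sign-square (inj₂ refl) = refl

  sign-* : ∀ {x y} → IsSign x → IsSign y → IsSign (x * y)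
  sign-* (inj₁ refl) (inj₁ refl) = inj₁ refl
  sign-* (inj₁ refl) (inj₂ refl) = inj₂ refl
  sign-* (inj₂ refl) (inj₁ refl) = inj₂ refl
  sign-* (inj₂ refl) (inj₂ refl) = inj₁ refl

  sign-neg : ∀ {x} → IsSign x → IsSign (- x)
  sign-neg (inj₁ refl) = inj₂ refl
  sign-neg (inj₂ refl) = inj₁ refl

  0≤i² : ∀ i → 0ℤ ≤ i * i
  0≤i² (+ zero)  = +≤+ ℕ.z≤n
  0≤i² (+ suc n) = +≤+ ℕ.z≤n
  0≤i² -[1+ n ]  = +≤+ ℕ.z≤n

  0≤i²-1 : ∀ {i} → i ≢ 0ℤ → 0ℤ ≤ i * i - 1ℤ
  0≤i²-1 {+ zero}  i≢0 = contradiction refl i≢0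
  0≤i²-1 {+ suc n} _   = ℤₚ.i≤j⇒0≤j-i (+≤+ (ℕ.s≤s ℕ.z≤n))
  0≤i²-1 { -[1+ n ]} _ = ℤₚ.i≤j⇒0≤j-i (+≤+ (ℕ.s≤s ℕ.z≤n))

  0≤i*j : ∀ {i j} → 0ℤ ≤ i → 0ℤ ≤ j → 0ℤ ≤ i * j
  0≤i*j {+ m} {+ n} _ _ = subst (0ℤ ≤_) (ℤₚ.pos-* m n) (+≤+ ℕ.z≤n)

  Even Odd : ℤ → Set
  Even z = ∃ λ w → z ≡ + 2 * w
  Odd  z = ∃ λ w → z ≡ 1ℤ + + 2 * w

  parity : ∀ z → Even z ⊎ Odd z
  parity z with z %ℕ 2 | n%ℕd<d z 2 | a≡a%ℕn+[a/ℕn]*n z 2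
  ... | 0 | _ | eq = inj₁ (z /ℕ 2 , trans eq (e _))
    where
    e : ∀ w → 0ℤ + w * + 2 ≡ + 2 * w
    e = solve-∀
  ... | 1 | _ | eq = inj₂ (z /ℕ 2 , trans eq (cong (_+_ 1ℤ) (ℤₚ.*-comm (z /ℕ 2) (+ 2))))
  ... | suc (suc _) | ℕ.s≤s (ℕ.s≤s ()) | _

  odd≢0 : ∀ {z} → Odd z → z ≢ 0ℤ
  odd≢0 (w , eq) z≡0 with ℕᵈ.∣1⇒≡1 (∣⇒∣ᵤ (divides {+ 2} {1ℤ} (- w)
    (trans (e w) (trans (cong (_+ - w * + 2) (trans (sym eq) z≡0)) (ℤₚ.+-identityˡ (- w * + 2))))))
    where
    e : ∀ w → 1ℤ ≡ 1ℤ + + 2 * w + - w * + 2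
    e = solve-∀
  ... | ()

  even-minus-odd : ∀ {a b} → Even a → Odd b → Odd (a - b)
  even-minus-odd (v , refl) (w , refl) = v - w - 1ℤ , e v w
    where
    e : ∀ v w → + 2 * v - (1ℤ + + 2 * w) ≡ 1ℤ + + 2 * (v - w - 1ℤ)
    e = solve-∀

  odd-minus-odd : ∀ {a b} → Odd a → Odd b → Even (a - b)
  odd-minus-odd (v , refl) (w , refl) = v - w , e v w
    where
    e : ∀ v w → 1ℤ + + 2 * v - (1ℤ + + 2 * w) ≡ + 2 * (v - w)
    e = solve-∀

  *-even : ∀ s {a} → Even a → Even (s * a)
  *-even s (v , refl) = s * v , e s v
    where
    e : ∀ s v → s * (+ 2 * v) ≡ + 2 * (s * v)
    e = solve-∀

  sign-*-odd : ∀ {s a} → IsSign s → Odd a → Odd (s * a)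
  sign-*-odd (inj₁ refl) (v , refl) = v , e v
    where
    e : ∀ v → 1ℤ * (1ℤ + + 2 * v) ≡ 1ℤ + + 2 * v
    e = solve-∀
  sign-*-odd (inj₂ refl) (v , refl) = - v - 1ℤ , e v
    where
    e : ∀ v → - 1ℤ * (1ℤ + + 2 * v) ≡ 1ℤ + + 2 * (- v - 1ℤ)
    e = solve-∀

  -- In the three quadratic bounds u is one of ±P, ±Q and w the other entry, for the halved row sums P, Q.
  quadratic-same : ∀ p u w → u - p ≢ 0ℤ ⊎ w ≢ 0ℤ →
    + 2 * p * u ≤ p * p - 1ℤ + u * u + w * w
  -- The difference of the two sides is `(u - p)² + w² - 1`, and one of the two squares is at least
  -- 1.
  quadratic-same p u w h = ℤₚ.0≤i-j⇒j≤i (nonneg h)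
    where
    e₁ : ∀ p u w → ((u - p) * (u - p) - 1ℤ) + w * w ≡ p * p - 1ℤ + u * u + w * w - + 2 * p * u
    e₁ = solve-∀
    e₂ : ∀ p u w → (u - p) * (u - p) + (w * w - 1ℤ) ≡ p * p - 1ℤ + u * u + w * w - + 2 * p * u
    e₂ = solve-∀
    nonneg : u - p ≢ 0ℤ ⊎ w ≢ 0ℤ → 0ℤ ≤ p * p - 1ℤ + u * u + w * w - + 2 * p * u
    nonneg (inj₁ u≢p) = subst (0ℤ ≤_) (e₁ p u w) (ℤₚ.+-mono-≤ (0≤i²-1 u≢p) (0≤i² w))
    nonneg (inj₂ w≢0) = subst (0ℤ ≤_) (e₂ p u w) (ℤₚ.+-mono-≤ (0≤i² (u - p)) (0≤i²-1 w≢0))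

  -- The weights p² + 1 and p² - 1 are forced: equality holds at (P , Q) = (p , 0) here and at (1 , p ± 1) in quadratic-even.
  quadratic-odd : ∀ p u w → 0ℤ ≤ p * p - 1ℤ → Even (u - p) →
    + 2 * p * (p * p - 1ℤ) * u ≤ p * p * (p * p - + 3) + (p * p + 1ℤ) * (u * u) + (p * p - 1ℤ) * (w * w)
  quadratic-odd p u w p²≥1 (v , u-p≡2v) =
    -- For `u = p + 2v` the difference of the two sides is `4((pv + 1)² + v² - 1) + (p² - 1)w²`. The
    -- bracket is zero at `v = 0`, and otherwise `v²` is at least 1.
    ℤₚ.0≤i-j⇒j≤i (subst (0ℤ ≤_) (sym (trans (cong deficit u≡) (e p v w)))
      (ℤₚ.+-mono-≤ (0≤i*j {+ 4} (+≤+ ℕ.z≤n) (square v)) (0≤i*j p²≥1 (0≤i² w))))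
    where
    deficit : ℤ → ℤ
    deficit u = p * p * (p * p - + 3) + (p * p + 1ℤ) * (u * u) + (p * p - 1ℤ) * (w * w)
                - + 2 * p * (p * p - 1ℤ) * u
    e′ : ∀ u p → u ≡ p + (u - p)
    e′ = solve-∀
    u≡ : u ≡ p + + 2 * v
    u≡ = trans (e′ u p) (cong (_+_ p) u-p≡2v)
    e : ∀ p v w →
      p * p * (p * p - + 3) + (p * p + 1ℤ) * ((p + + 2 * v) * (p + + 2 * v)) + (p * p - 1ℤ) * (w * w)
        - + 2 * p * (p * p - 1ℤ) * (p + + 2 * v)
      ≡ + 4 * ((p * v + 1ℤ) * (p * v + 1ℤ) + v * v - 1ℤ) + (p * p - 1ℤ) * (w * w)
    e = solve-∀
    e″ : ∀ p v → (p * v + 1ℤ) * (p * v + 1ℤ) + (v * v - 1ℤ) ≡ (p * v + 1ℤ) * (p * v + 1ℤ) + v * v - 1ℤ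
    e″ = solve-∀
    square : ∀ v → 0ℤ ≤ (p * v + 1ℤ) * (p * v + 1ℤ) + v * v - 1ℤ
    square v with v ℤₚ.≟ 0ℤ
    ... | yes refl = ℤₚ.≤-reflexive (sym (cong (λ t → (t + 1ℤ) * (t + 1ℤ) + 0ℤ - 1ℤ) (ℤₚ.*-zeroʳ p)))
    ... | no v≢0   = subst (0ℤ ≤_) (e″ p v) (ℤₚ.+-mono-≤ (0≤i² (p * v + 1ℤ)) (0≤i²-1 v≢0))

  -- The difference of the two sides splits as `(p² - 1)((u - p)² - 1) + (p² + 1)(w² - 1)`. The
  -- heavier weight stays with the odd entry, which is now `w`.
  quadratic-even : ∀ p u w → 0ℤ ≤ p * p - 1ℤ → u - p ≢ 0ℤ → w ≢ 0ℤ →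
    + 2 * p * (p * p - 1ℤ) * u ≤ p * p * (p * p - + 3) + (p * p + 1ℤ) * (w * w) + (p * p - 1ℤ) * (u * u)
  quadratic-even p u w p²≥1 u≢p w≢0 =
    ℤₚ.0≤i-j⇒j≤i (subst (0ℤ ≤_) (e p u w)
      (ℤₚ.+-mono-≤ (0≤i*j p²≥1 (0≤i²-1 u≢p))
                   (0≤i*j (ℤₚ.+-mono-≤ (0≤i² p) (+≤+ {0} {1} ℕ.z≤n)) (0≤i²-1 w≢0))))
    where
    e : ∀ p u w → (p * p - 1ℤ) * ((u - p) * (u - p) - 1ℤ) + (p * p + 1ℤ) * (w * w - 1ℤ) ≡
      p * p * (p * p - + 3) + (p * p + 1ℤ) * (w * w) + (p * p - 1ℤ) * (u * u) - + 2 * p * (p * p - 1ℤ) * u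
    e = solve-∀

  -- Row sums of Hadamard matrices

  infixr 8 _·_

  _·_ : ∀ {n} → Matrix n → (Fin n → ℤ) → Fin n → ℤ
  (M · v) i = sumFin (λ j → M i j * v j)

  dot : ∀ {n} → (Fin n → ℤ) → (Fin n → ℤ) → ℤ
  dot u v = sumFin (λ i → u i * v i)

  adjoint : ∀ {n} (M : Matrix n) u v → dot u (M · v) ≡ dot ((M ᵗ) · u) v
  adjoint M u v = begin
    sumFin (λ i → u i * sumFin (λ j → M i j * v j))
      ≡⟨ sum-cong (λ i → sym (sum-*ˡ (u i) (λ j → M i j * v j))) ⟩
    sumFin (λ i → sumFin (λ j → u i * (M i j * v j)))
      ≡⟨ sum-swap (λ i j → u i * (M i j * v j)) ⟩
    sumFin (λ j → sumFin (λ i → u i * (M i j * v j)))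
      ≡⟨ sum-cong (λ j → trans (sum-cong (λ i → e (u i) (M i j) (v j))) (sum-*ʳ (v j) (λ i → M i j * u i))) ⟩
    sumFin (λ j → sumFin (λ i → M i j * u i) * v j) ∎
    where
    open ≡-Reasoning
    e : ∀ a m b → a * (m * b) ≡ m * a * b
    e = solve-∀

  ·-⊗ : ∀ {n} (M N : Matrix n) v i → (M · N · v) i ≡ ((M ⊗ N) · v) i
  ·-⊗ M N v i = trans (adjoint N (M i) v)
    (sum-cong λ k → cong (_* v k) (sum-cong λ j → ℤₚ.*-comm (N j k) (M i j)))

  IsSymmetric : ∀ {n} → Matrix n → Set
  IsSymmetric M = ∀ i j → M i j ≡ M j i

  -- Symmetry turns `Kᵗ K` into `K Kᵗ`, which acts as the scalar `n`; moving one factor `K` across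
  -- the dot product leaves `n` times the norm of `v`.
  norm-hadamard : ∀ {n} {K : Matrix n} → IsHadamard n K → IsSymmetric K →
    ∀ v → dot (K · v) (K · v) ≡ + n * dot v v
  norm-hadamard {n} {K} (_ , KKᵗ) symm v = begin
    dot (K · v) (K · v)
      ≡⟨ adjoint K (K · v) v ⟩
    dot ((K ᵗ) · K · v) v
      ≡⟨ sum-cong (λ i → cong (_* v i) (gram i)) ⟩
    dot (λ i → + n * v i) v
      ≡⟨ sum-cong (λ i → ℤₚ.*-assoc (+ n) (v i) (v i)) ⟩
    sumFin (λ i → + n * (v i * v i))
      ≡⟨ sum-*ˡ (+ n) (λ i → v i * v i) ⟩
    + n * dot v v ∎
    where
    open ≡-Reasoning
    gram : ∀ i → ((K ᵗ) · K · v) i ≡ + n * v i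
    gram i = begin
      ((K ᵗ) · K · v) i
        ≡⟨ sum-cong (λ j → cong₂ _*_ (symm j i) (sum-cong (λ l → cong (_* v l) (symm j l)))) ⟩
      (K · (K ᵗ) · v) i
        ≡⟨ ·-⊗ K (K ᵗ) v i ⟩
      ((K ⊗ (K ᵗ)) · v) i
        ≡⟨ sum-cong (λ j → cong (_* v j) (KKᵗ i j)) ⟩
      sumFin (λ j → scalarId (+ n) i j * v j)
        ≡⟨ sum-scalarId (+ n) i v ⟩
      + n * v i ∎

  dot-sign : ∀ {n} {y : Fin n → ℤ} → (∀ i → IsSign (y i)) → dot y y ≡ + n
  dot-sign {n} sy = trans (sum-cong (sign-square ∘ sy)) (trans (sum-const n 1ℤ) (ℤₚ.*-identityʳ (+ n)))

  sum-∣ : ∀ {n d} {f : Fin n → ℤ} → (∀ i → d ∣ f i) → d ∣ sumFin f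
  sum-∣ {zero}  h = divides 0ℤ refl
  sum-∣ {suc n} h = ∣m∣n⇒∣m+n (h zero) (sum-∣ (h ∘ suc))

  2∣1+sign : ∀ {s} → IsSign s → + 2 ∣ 1ℤ + s
  2∣1+sign (inj₁ refl) = divides 1ℤ refl
  2∣1+sign (inj₂ refl) = divides 0ℤ refl

  2∣⇒even : ∀ {z} → + 2 ∣ z → Even z
  2∣⇒even (divides q eq) = q , trans eq (ℤₚ.*-comm q (+ 2))

  module _ {k} {K : Matrix k} (had : IsHadamard k K) (4∣k : + 4 ∣ + k)
           {y : Fin k → ℤ} (sy : ∀ j → IsSign (y j)) where

    -- Each `1 + K i j * y j` is 0 or 2, so `k` plus the row sum is even, and `k` itself is even.
    rowSum-even : ∀ i → Even ((K · y) i)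
    rowSum-even i = 2∣⇒even (∣m+n∣m⇒∣n {+ 2} {+ k} (subst (+ 2 ∣_) total
      (sum-∣ λ j → 2∣1+sign (sign-* (proj₁ had i j) (sy j)))) (∣-trans (divides (+ 2) refl) 4∣k))
      where
      total : sumFin (λ j → 1ℤ + K i j * y j) ≡ + k + (K · y) i
      total = trans (sum-+ (λ _ → 1ℤ) (λ j → K i j * y j))
                    (cong (_+ (K · y) i) (trans (sum-const k 1ℤ) (ℤₚ.*-identityʳ (+ k))))

    -- Sum (1 + a)(1 + b), a multiple of 4 for signs a and b, over two orthogonal rows.
    rowSums-mod4 : ∀ i l → + 4 ∣ (K · y) i + (K · y) l
    rowSums-mod4 i l = ∣m+n∣m⇒∣n {+ 4} {+ k + scalarId (+ k) i l} (subst (+ 4 ∣_) total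
        (sum-∣ λ j → product (2∣1+sign (sign-* (proj₁ had i j) (sy j))) (2∣1+sign (sign-* (proj₁ had l j) (sy j)))))
        (∣m∣n⇒∣m+n 4∣k 4∣scalarId)
      where
      product : ∀ {a b} → + 2 ∣ a → + 2 ∣ b → + 4 ∣ a * b
      product (divides q refl) (divides r refl) = divides (q * r) (e q r)
        where
        e : ∀ q r → q * + 2 * (r * + 2) ≡ q * r * + 4
        e = solve-∀
      4∣scalarId : + 4 ∣ scalarId (+ k) i l
      4∣scalarId with i ≟ l
      ... | yes _ = 4∣k
      ... | no  _ = divides 0ℤ refl
      expand : ∀ a b y → (1ℤ + a * y) * (1ℤ + b * y) ≡ 1ℤ + a * b * (y * y) + (a * y + b * y)
      expand = solve-∀
      total : sumFin (λ j → (1ℤ + K i j * y j) * (1ℤ + K l j * y j)) ≡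
              + k + scalarId (+ k) i l + ((K · y) i + (K · y) l)
      total = begin
        sumFin (λ j → (1ℤ + K i j * y j) * (1ℤ + K l j * y j))
          ≡⟨ sum-cong (λ j → trans (expand (K i j) (K l j) (y j))
               (cong (λ t → 1ℤ + t + (K i j * y j + K l j * y j))
                 (trans (cong (K i j * K l j *_) (sign-square (sy j))) (ℤₚ.*-identityʳ (K i j * K l j))))) ⟩
        sumFin (λ j → 1ℤ + K i j * K l j + (K i j * y j + K l j * y j))
          ≡⟨ sum-+ (λ j → 1ℤ + K i j * K l j) (λ j → K i j * y j + K l j * y j) ⟩
        sumFin (λ j → 1ℤ + K i j * K l j) + sumFin (λ j → K i j * y j + K l j * y j)
          ≡⟨ cong₂ _+_ (sum-+ (λ _ → 1ℤ) (λ j → K i j * K l j)) (sum-+ (λ j → K i j * y j) (λ j → K l j * y j)) ⟩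
        sumFin {k} (λ _ → 1ℤ) + (K ⊗ (K ᵗ)) i l + ((K · y) i + (K · y) l)
          ≡⟨ cong₂ (λ s t → s + t + ((K · y) i + (K · y) l))
               (trans (sum-const k 1ℤ) (ℤₚ.*-identityʳ (+ k))) (proj₂ had i l) ⟩
        + k + scalarId (+ k) i l + ((K · y) i + (K · y) l) ∎
        where open ≡-Reasoning

  -- The bound for a doubled Hadamard matrix

  -- The hypothesis says that `P i + P l` is even, so the parity of the entry at `zero` decides all
  -- others.
  uniform-parity : ∀ {k} (P : Fin k → ℤ) → (∀ i l → + 4 ∣ + 2 * P i + + 2 * P l) →
    (∀ i → Even (P i)) ⊎ (∀ i → Odd (P i))
  uniform-parity {zero}  P h = inj₁ λ ()
  uniform-parity {suc k} P h with parity (P zero)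
  ... | inj₁ (w , P₀≡2w) = inj₁ λ i → even (h i zero)
    where
    even : ∀ {a} → + 4 ∣ + 2 * a + + 2 * P zero → Even a
    even {a} (divides q eq) = q - w , ℤₚ.*-cancelˡ-≡ (+ 2) a (+ 2 * (q - w)) (trans (e₁ a (P zero))
        (trans (cong₂ (λ s t → s - + 2 * t) eq P₀≡2w) (e₂ q w)))
      where
      e₁ : ∀ a b → + 2 * a ≡ + 2 * a + + 2 * b - + 2 * b
      e₁ = solve-∀
      e₂ : ∀ q w → q * + 4 - + 2 * (+ 2 * w) ≡ + 2 * (+ 2 * (q - w))
      e₂ = solve-∀
  ... | inj₂ (w , P₀≡1+2w) = inj₂ λ i → odd (h i zero)
    where
    odd : ∀ {a} → + 4 ∣ + 2 * a + + 2 * P zero → Odd a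
    odd {a} (divides q eq) = q - w - 1ℤ , ℤₚ.*-cancelˡ-≡ (+ 2) a (1ℤ + + 2 * (q - w - 1ℤ)) (trans (e₁ a (P zero))
        (trans (cong₂ (λ s t → s - + 2 * t) eq P₀≡1+2w) (e₂ q w)))
      where
      e₁ : ∀ a b → + 2 * a ≡ + 2 * a + + 2 * b - + 2 * b
      e₁ = solve-∀
      e₂ : ∀ q w → q * + 4 - + 2 * (1ℤ + + 2 * w) ≡ + 2 * (1ℤ + + 2 * (q - w - 1ℤ))
      e₂ = solve-∀

  -- If `s = t` the multiples of `Q` cancel, and if `s = - t` those of `P` do. The sign `r` is `s`
  -- in all four cases, so a row contributes four times a signed halved entry.
  signed-pair : ∀ {s t} → IsSign s → IsSign t → ∀ P Q →
    ∃ λ r → IsSign r × (s * (+ 2 * P + + 2 * Q) + t * (+ 2 * P - + 2 * Q) ≡ + 4 * (r * P) ⊎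
                        s * (+ 2 * P + + 2 * Q) + t * (+ 2 * P - + 2 * Q) ≡ + 4 * (r * Q))
  signed-pair {s} ss (inj₁ refl) P Q with ss
  ... | inj₁ refl = 1ℤ , inj₁ refl , inj₁ (e P Q)
    where
    e : ∀ P Q → 1ℤ * (+ 2 * P + + 2 * Q) + 1ℤ * (+ 2 * P - + 2 * Q) ≡ + 4 * (1ℤ * P)
    e = solve-∀
  ... | inj₂ refl = - 1ℤ , inj₂ refl , inj₂ (e P Q)
    where
    e : ∀ P Q → - 1ℤ * (+ 2 * P + + 2 * Q) + 1ℤ * (+ 2 * P - + 2 * Q) ≡ + 4 * (- 1ℤ * Q)
    e = solve-∀
  signed-pair {s} ss (inj₂ refl) P Q with ss
  ... | inj₁ refl = 1ℤ , inj₁ refl , inj₂ (e P Q)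
    where
    e : ∀ P Q → 1ℤ * (+ 2 * P + + 2 * Q) + - 1ℤ * (+ 2 * P - + 2 * Q) ≡ + 4 * (1ℤ * Q)
    e = solve-∀
  ... | inj₂ refl = - 1ℤ , inj₂ refl , inj₁ (e P Q)
    where
    e : ∀ P Q → - 1ℤ * (+ 2 * P + + 2 * Q) + - 1ℤ * (+ 2 * P - + 2 * Q) ≡ + 4 * (- 1ℤ * P)
    e = solve-∀

  sign-absorb : ∀ {r} → IsSign r → ∀ a → r * a * (r * a) ≡ a * a
  sign-absorb (inj₁ refl) = e
    where
    e : ∀ a → 1ℤ * a * (1ℤ * a) ≡ a * a
    e = solve-∀
  sign-absorb (inj₂ refl) = e
    where
    e : ∀ a → - 1ℤ * a * (- 1ℤ * a) ≡ a * a
    e = solve-∀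

  -- The entries of `A` and `B` enter the row bounds only through their squares, whose totals are
  -- fixed, so the summed bound is the same for all sign vectors. The positive multiplier `D` clears
  -- the denominators of the weights.
  sum-weighted-≤ : ∀ {k} {V A B : Fin k → ℤ} (D α β γ c : ℤ) .{{_ : Positive D}} →
    dot A A ≡ + k * + k → dot B B ≡ + k * + k →
    (∀ i → D * V i ≤ α + (β * (A i * A i) + γ * (B i * B i))) →
    + k * α + (β + γ) * (+ k * + k) ≡ D * c → sumFin V ≤ c
  sum-weighted-≤ {k} {V} {A} {B} D α β γ c A² B² row total = ℤₚ.*-cancelˡ-≤-pos (sumFin V) c D (begin
    D * sumFin V
      ≡⟨ sum-*ˡ D V ⟨
    sumFin (λ i → D * V i)
      ≤⟨ sum-mono row ⟩
    sumFin (λ i → α + (β * (A i * A i) + γ * (B i * B i)))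
      ≡⟨ sum-+ (λ _ → α) (λ i → β * (A i * A i) + γ * (B i * B i)) ⟩
    sumFin {k} (λ _ → α) + sumFin (λ i → β * (A i * A i) + γ * (B i * B i))
      ≡⟨ cong₂ _+_ (sum-const k α) (sum-+ (λ i → β * (A i * A i)) (λ i → γ * (B i * B i))) ⟩
    + k * α + (sumFin (λ i → β * (A i * A i)) + sumFin (λ i → γ * (B i * B i)))
      ≡⟨ cong₂ (λ s t → + k * α + (s + t)) (trans (sum-*ˡ β (λ i → A i * A i)) (cong (β *_) A²))
                                           (trans (sum-*ˡ γ (λ i → B i * B i)) (cong (γ *_) B²)) ⟩
    + k * α + (β * (+ k * + k) + γ * (+ k * + k))
      ≡⟨ cong (_+_ (+ k * α)) (ℤₚ.*-distribʳ-+ (+ k * + k) β γ) ⟨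
    + k * α + (β + γ) * (+ k * + k)
      ≡⟨ total ⟩
    D * c ∎)
    where open ℤₚ.≤-Reasoning

  scale-≤ : ∀ {D u V R S} → D * u ≤ R → V ≡ + 4 * u → + 4 * R ≡ S → D * V ≤ S
  scale-≤ {D} {u} {V} {R} {S} Du≤R V≡4u 4R≡S = begin
    D * V           ≡⟨ cong (D *_) V≡4u ⟩
    D * (+ 4 * u)   ≡⟨ e D u ⟩
    + 4 * (D * u)   ≤⟨ ℤₚ.*-monoˡ-≤-nonNeg (+ 4) Du≤R ⟩
    + 4 * R         ≡⟨ 4R≡S ⟩
    S               ∎
    where
    open ℤₚ.≤-Reasoning
    e : ∀ D u → D * (+ 4 * u) ≡ + 4 * (D * u)
    e = solve-∀

  -- Writing `p` as `suc (suc n)` lets the positivity of the multipliers `2p` and `2p(p² - 1)` be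
  -- found by computation.
  module _ (n : ℕ) (p-odd : Odd (+ suc (suc n))) {k} (k≡ : + k ≡ + 2 * (1ℤ + + suc (suc n) * + suc (suc n))) where

    private
      p : ℤ
      p = + suc (suc n)

      p²≥1 : 0ℤ ≤ p * p - 1ℤ
      p²≥1 = 0≤i²-1 {p} λ ()

    same-parity-total : + k * (+ 4 * (p * p - 1ℤ)) + (1ℤ + 1ℤ) * (+ k * + k) ≡
      + 2 * p * (+ 8 * p * (1ℤ + p * p))
    same-parity-total = trans (cong (λ k → k * (+ 4 * (p * p - 1ℤ)) + (1ℤ + 1ℤ) * (k * k)) k≡) (e p)
      where
      e : ∀ p → + 2 * (1ℤ + p * p) * (+ 4 * (p * p - 1ℤ)) +
          (1ℤ + 1ℤ) * (+ 2 * (1ℤ + p * p) * (+ 2 * (1ℤ + p * p))) ≡ + 2 * p * (+ 8 * p * (1ℤ + p * p))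
      e = solve-∀

    mixed-parity-total : + k * (+ 4 * (p * p * (p * p - + 3))) + (p * p + 1ℤ + (p * p - 1ℤ)) * (+ k * + k) ≡
      + 2 * p * (p * p - 1ℤ) * (+ 8 * p * (1ℤ + p * p))
    mixed-parity-total = trans
      (cong (λ k → k * (+ 4 * (p * p * (p * p - + 3))) + (p * p + 1ℤ + (p * p - 1ℤ)) * (k * k)) k≡) (e p)
      where
      e : ∀ p → + 2 * (1ℤ + p * p) * (+ 4 * (p * p * (p * p - + 3))) +
          (p * p + 1ℤ + (p * p - 1ℤ)) * (+ 2 * (1ℤ + p * p) * (+ 2 * (1ℤ + p * p))) ≡
          + 2 * p * (p * p - 1ℤ) * (+ 8 * p * (1ℤ + p * p))
      e = solve-∀

    -- Whichever entry survives in `signed-pair`, equal parity supplies what `quadratic-same` asks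
    -- for: if both are even, the survivor differs from the odd `p`; if both are odd, the other
    -- entry is nonzero.
    same-parity-row : ∀ {s t} → IsSign s → IsSign t → ∀ P Q → (Even P × Even Q) ⊎ (Odd P × Odd Q) →
      + 2 * p * (s * (+ 2 * P + + 2 * Q) + t * (+ 2 * P - + 2 * Q)) ≤
      + 4 * (p * p - 1ℤ) + (1ℤ * (+ 2 * P * (+ 2 * P)) + 1ℤ * (+ 2 * Q * (+ 2 * Q)))
    same-parity-row ss st P Q par with signed-pair ss st P Q
    ... | r , sr , inj₁ V≡ = scale-≤ {+ 2 * p} {r * P} (quadratic-same p (r * P) Q (nonzero par)) V≡
            (trans (cong (λ t → + 4 * (p * p - 1ℤ + t + Q * Q)) (sign-absorb sr P)) (e p P Q))
      where
      nonzero : (Even P × Even Q) ⊎ (Odd P × Odd Q) → r * P - p ≢ 0ℤ ⊎ Q ≢ 0ℤ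
      nonzero (inj₁ (eP , _)) = inj₁ (odd≢0 (even-minus-odd (*-even r eP) p-odd))
      nonzero (inj₂ (_ , oQ)) = inj₂ (odd≢0 oQ)
      e : ∀ p P Q → + 4 * (p * p - 1ℤ + P * P + Q * Q) ≡
        + 4 * (p * p - 1ℤ) + (1ℤ * (+ 2 * P * (+ 2 * P)) + 1ℤ * (+ 2 * Q * (+ 2 * Q)))
      e = solve-∀
    ... | r , sr , inj₂ V≡ = scale-≤ {+ 2 * p} {r * Q} (quadratic-same p (r * Q) P (nonzero par)) V≡
            (trans (cong (λ t → + 4 * (p * p - 1ℤ + t + P * P)) (sign-absorb sr Q)) (e p P Q))
      where
      nonzero : (Even P × Even Q) ⊎ (Odd P × Odd Q) → r * Q - p ≢ 0ℤ ⊎ P ≢ 0ℤ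
      nonzero (inj₁ (_ , eQ)) = inj₁ (odd≢0 (even-minus-odd (*-even r eQ) p-odd))
      nonzero (inj₂ (oP , _)) = inj₂ (odd≢0 oP)
      e : ∀ p P Q → + 4 * (p * p - 1ℤ + Q * Q + P * P) ≡
        + 4 * (p * p - 1ℤ) + (1ℤ * (+ 2 * P * (+ 2 * P)) + 1ℤ * (+ 2 * Q * (+ 2 * Q)))
      e = solve-∀

    -- The survivor in `signed-pair` may be the odd entry, handled by `quadratic-odd`, or the even
    -- one, handled by `quadratic-even`. Both lemmas give the odd entry the weight `p² + 1`, so one
    -- row bound covers both.
    mixed-parity-row : ∀ {s t} → IsSign s → IsSign t → ∀ P Q → Odd P → Even Q →
      + 2 * p * (p * p - 1ℤ) * (s * (+ 2 * P + + 2 * Q) + t * (+ 2 * P - + 2 * Q)) ≤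
      + 4 * (p * p * (p * p - + 3)) + ((p * p + 1ℤ) * (+ 2 * P * (+ 2 * P)) + (p * p - 1ℤ) * (+ 2 * Q * (+ 2 * Q)))
    mixed-parity-row ss st P Q oP eQ with signed-pair ss st P Q
    ... | r , sr , inj₁ V≡ = scale-≤ {+ 2 * p * (p * p - 1ℤ)} {r * P}
            (quadratic-odd p (r * P) Q p²≥1 (odd-minus-odd (sign-*-odd sr oP) p-odd)) V≡
            (trans (cong (λ t → + 4 * (p * p * (p * p - + 3) + (p * p + 1ℤ) * t + (p * p - 1ℤ) * (Q * Q)))
                         (sign-absorb sr P)) (e p P Q))
      where
      e : ∀ p P Q → + 4 * (p * p * (p * p - + 3) + (p * p + 1ℤ) * (P * P) + (p * p - 1ℤ) * (Q * Q)) ≡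
        + 4 * (p * p * (p * p - + 3)) + ((p * p + 1ℤ) * (+ 2 * P * (+ 2 * P)) + (p * p - 1ℤ) * (+ 2 * Q * (+ 2 * Q)))
      e = solve-∀
    ... | r , sr , inj₂ V≡ = scale-≤ {+ 2 * p * (p * p - 1ℤ)} {r * Q}
            (quadratic-even p (r * Q) P p²≥1 (odd≢0 (even-minus-odd (*-even r eQ) p-odd)) (odd≢0 oP)) V≡
            (trans (cong (λ t → + 4 * (p * p * (p * p - + 3) + (p * p + 1ℤ) * (P * P) + (p * p - 1ℤ) * t))
                         (sign-absorb sr Q)) (e p P Q))
      where
      e : ∀ p P Q → + 4 * (p * p * (p * p - + 3) + (p * p + 1ℤ) * (P * P) + (p * p - 1ℤ) * (Q * Q)) ≡
        + 4 * (p * p * (p * p - + 3)) + ((p * p + 1ℤ) * (+ 2 * P * (+ 2 * P)) + (p * p - 1ℤ) * (+ 2 * Q * (+ 2 * Q)))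
      e = solve-∀

    4∣k : + 4 ∣ + k
    4∣k = divides (1ℤ + + 2 * w + + 2 * w * w)
      (trans k≡ (trans (cong (λ p → + 2 * (1ℤ + p * p)) (proj₂ p-odd)) (e w)))
      where
      w : ℤ
      w = proj₁ p-odd
      e : ∀ w → + 2 * (1ℤ + (1ℤ + + 2 * w) * (1ℤ + + 2 * w)) ≡ (1ℤ + + 2 * w + + 2 * w * w) * + 4
      e = solve-∀

    parity-bound : ∀ {s t : Fin k → ℤ} → (∀ i → IsSign (s i)) → (∀ i → IsSign (t i)) → (P Q : Fin k → ℤ) →
      dot (λ i → + 2 * P i) (λ i → + 2 * P i) ≡ + k * + k → dot (λ i → + 2 * Q i) (λ i → + 2 * Q i) ≡ + k * + k →
      (∀ i → Even (P i)) ⊎ (∀ i → Odd (P i)) → (∀ i → Even (Q i)) ⊎ (∀ i → Odd (Q i)) →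
      sumFin (λ i → s i * (+ 2 * P i + + 2 * Q i) + t i * (+ 2 * P i - + 2 * Q i)) ≤ + 8 * p * (1ℤ + p * p)
    parity-bound {s} {t} ss st P Q P² Q² (inj₁ eP) (inj₁ eQ) =
      sum-weighted-≤ {A = λ i → + 2 * P i} {B = λ i → + 2 * Q i}
        (+ 2 * p) (+ 4 * (p * p - 1ℤ)) 1ℤ 1ℤ (+ 8 * p * (1ℤ + p * p)) P² Q²
        (λ i → same-parity-row (ss i) (st i) (P i) (Q i) (inj₁ (eP i , eQ i))) same-parity-total
    parity-bound {s} {t} ss st P Q P² Q² (inj₂ oP) (inj₂ oQ) =
      sum-weighted-≤ {A = λ i → + 2 * P i} {B = λ i → + 2 * Q i}
        (+ 2 * p) (+ 4 * (p * p - 1ℤ)) 1ℤ 1ℤ (+ 8 * p * (1ℤ + p * p)) P² Q²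
        (λ i → same-parity-row (ss i) (st i) (P i) (Q i) (inj₂ (oP i , oQ i))) same-parity-total
    parity-bound {s} {t} ss st P Q P² Q² (inj₂ oP) (inj₁ eQ) =
      sum-weighted-≤ {A = λ i → + 2 * P i} {B = λ i → + 2 * Q i}
        (+ 2 * p * (p * p - 1ℤ)) (+ 4 * (p * p * (p * p - + 3))) (p * p + 1ℤ) (p * p - 1ℤ)
        (+ 8 * p * (1ℤ + p * p)) P² Q²
        (λ i → mixed-parity-row (ss i) (st i) (P i) (Q i) (oP i) (eQ i)) mixed-parity-total
    parity-bound {s} {t} ss st P Q P² Q² (inj₁ eP) (inj₂ oQ) =
      -- Exchanging `P` and `Q` changes the sign of their difference, which `- t` compensates; this
      -- reduces to the preceding case.
      subst (_≤ + 8 * p * (1ℤ + p * p)) (sum-cong λ i → swap (s i) (t i) (P i) (Q i))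
        (parity-bound ss (sign-neg ∘ st) Q P Q² P² (inj₂ oQ) (inj₁ eP))
      where
      swap : ∀ s t P Q → s * (+ 2 * Q + + 2 * P) + (- t) * (+ 2 * Q - + 2 * P) ≡
        s * (+ 2 * P + + 2 * Q) + t * (+ 2 * P - + 2 * Q)
      swap = solve-∀

    -- The sum is the bilinear form of `[[K, K], [K, -K]]` at the sign vectors `(s, t)` and
    -- `(y, z)`, as `double-form` shows. Halving the even row sums of `K` brings it to
    -- `parity-bound`.
    doubled-bound : ∀ {K : Matrix k} → IsHadamard k K → IsSymmetric K → ∀ {s t y z : Fin k → ℤ} →
      (∀ i → IsSign (s i)) → (∀ i → IsSign (t i)) → (∀ i → IsSign (y i)) → (∀ i → IsSign (z i)) →
      sumFin (λ i → s i * ((K · y) i + (K · z) i) + t i * ((K · y) i - (K · z) i)) ≤ + 8 * p * (1ℤ + p * p)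
    doubled-bound {K} had symm {s} {t} {y} {z} ss st sy sz =
      halved (K · y) (rowSum-even had 4∣k sy) (norm sy) (rowSums-mod4 had 4∣k sy)
             (K · z) (rowSum-even had 4∣k sz) (norm sz) (rowSums-mod4 had 4∣k sz)
      where
      norm : ∀ {y} → (∀ i → IsSign (y i)) → dot (K · y) (K · y) ≡ + k * + k
      norm {y} sy = trans (norm-hadamard had symm y) (cong (+ k *_) (dot-sign sy))
      halved : ∀ (A : Fin k → ℤ) → (∀ i → Even (A i)) → dot A A ≡ + k * + k → (∀ i l → + 4 ∣ A i + A l) →
               ∀ (B : Fin k → ℤ) → (∀ i → Even (B i)) → dot B B ≡ + k * + k → (∀ i l → + 4 ∣ B i + B l) →
               sumFin (λ i → s i * (A i + B i) + t i * (A i - B i)) ≤ + 8 * p * (1ℤ + p * p)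
      halved A eA A² A₄ B eB B² B₄ =
        subst (_≤ + 8 * p * (1ℤ + p * p))
          (sum-cong λ i → sym (cong₂ (λ a b → s i * (a + b) + t i * (a - b)) (A≡ i) (B≡ i)))
          (parity-bound ss st P Q
            (trans (sum-cong λ i → sym (cong₂ _*_ (A≡ i) (A≡ i))) A²)
            (trans (sum-cong λ i → sym (cong₂ _*_ (B≡ i) (B≡ i))) B²)
            (uniform-parity P λ i l → subst (+ 4 ∣_) (cong₂ _+_ (A≡ i) (A≡ l)) (A₄ i l))
            (uniform-parity Q λ i l → subst (+ 4 ∣_) (cong₂ _+_ (B≡ i) (B≡ l)) (B₄ i l)))
        where
        P Q : Fin k → ℤ
        P i = proj₁ (eA i)
        Q i = proj₁ (eB i)
        A≡ : ∀ i → A i ≡ + 2 * P i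
        A≡ i = proj₂ (eA i)
        B≡ : ∀ i → B i ≡ + 2 * Q i
        B≡ i = proj₂ (eB i)

  -- Signed equivalence and doubling

  ones : ∀ {n} → Fin n → ℤ
  ones _ = 1ℤ

  excess-ones : ∀ {n} (M : Matrix n) → excess M ≡ dot ones (M · ones)
  excess-ones M = sum-cong λ i → sym (trans (ℤₚ.*-identityˡ _) (sum-cong λ j → ℤₚ.*-identityʳ (M i j)))

  -- The excess is the bilinear form of the matrix at the all-ones vectors, and `P` and `Q` can be
  -- moved onto these vectors. For signed permutations the results are again sign vectors.
  excess-⊗ : ∀ {n} (P H Q : Matrix n) → excess ((P ⊗ H) ⊗ Q) ≡ dot ((P ᵗ) · ones) (H · Q · ones)
  excess-⊗ P H Q = begin
    excess ((P ⊗ H) ⊗ Q)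
      ≡⟨ excess-ones ((P ⊗ H) ⊗ Q) ⟩
    dot ones (((P ⊗ H) ⊗ Q) · ones)
      ≡⟨ sum-cong (λ i → cong (1ℤ *_) (sym (trans (·-⊗ P H (Q · ones) i) (·-⊗ (P ⊗ H) Q ones i)))) ⟩
    dot ones (P · H · Q · ones)
      ≡⟨ adjoint P ones (H · Q · ones) ⟩
    dot ((P ᵗ) · ones) (H · Q · ones) ∎
    where open ≡-Reasoning

  rowSum-signedPerm : ∀ {n} {Q : Matrix n} → IsSignedPerm n Q → ∀ k → IsSign ((Q · ones) k)
  rowSum-signedPerm {Q = Q} (σ , entries) k = subst IsSign
    (sym (trans (sum-single (σ ⟨$⟩ʳ k) λ j j≢ → trans (ℤₚ.*-identityʳ (Q k j)) (proj₂ (entries k j) j≢))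
                (ℤₚ.*-identityʳ (Q k (σ ⟨$⟩ʳ k)))))
    (proj₁ (entries k (σ ⟨$⟩ʳ k)) refl)

  colSum-signedPerm : ∀ {n} {P : Matrix n} → IsSignedPerm n P → ∀ l → IsSign (((P ᵗ) · ones) l)
  colSum-signedPerm {P = P} (σ , entries) l = subst IsSign
    (sym (trans (sum-single (σ ⟨$⟩ˡ l) λ i i≢ → trans (ℤₚ.*-identityʳ (P i l))
                   (proj₂ (entries i l) λ l≡ → i≢ (trans (sym (inverseˡ σ)) (cong (σ ⟨$⟩ˡ_) (sym l≡)))))
                (ℤₚ.*-identityʳ (P (σ ⟨$⟩ˡ l) l))))
    (proj₁ (entries (σ ⟨$⟩ˡ l) l) (sym (inverseʳ σ)))

  -- Order and value are parameters so that both can be rewritten at the end into the closed forms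
  -- of the theorem.
  MaximalExcess : (n : ℕ) → ℤ → Set
  MaximalExcess n e = Σ (Matrix n) λ H →
    IsHadamard n H × excess H ≡ e × (∀ K → Equivalent n K H → excess K ≤ e)

  -- This is `D H D` for the diagonal matrix `D` of `ε`; its excess is the bilinear form of `H` at
  -- `(ε, ε)`.
  resign : ∀ {n} → (Fin n → ℤ) → Matrix n → Matrix n
  resign ε H i j = ε i * (H i j * ε j)

  resign-hadamard : ∀ {n} {ε : Fin n → ℤ} {H : Matrix n} → (∀ i → IsSign (ε i)) → IsHadamard n H → IsHadamard n (resign ε H)
  resign-hadamard {n} {ε} {H} sε (sH , HHᵗ) =
    (λ i j → sign-* (sε i) (sign-* (sH i j) (sε j))) , orthogonal
    where
    open ≡-Reasoning
    e : ∀ a b c d f → a * (b * c) * (d * (f * c)) ≡ a * d * (b * f) * (c * c)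
    e = solve-∀
    absorb : ∀ i j → ε i * ε j * scalarId (+ n) i j ≡ scalarId (+ n) i j
    absorb i j with i ≟ j
    ... | yes refl = trans (cong (_* + n) (sign-square (sε i))) (ℤₚ.*-identityˡ (+ n))
    ... | no  _    = ℤₚ.*-zeroʳ (ε i * ε j)
    orthogonal : ∀ i j → (resign ε H ⊗ (resign ε H ᵗ)) i j ≡ scalarId (+ n) i j
    orthogonal i j = begin
      sumFin (λ k → ε i * (H i k * ε k) * (ε j * (H j k * ε k)))
        ≡⟨ sum-cong (λ k → trans (e (ε i) (H i k) (ε k) (ε j) (H j k))
             (trans (cong (ε i * ε j * (H i k * H j k) *_) (sign-square (sε k)))
                    (ℤₚ.*-identityʳ (ε i * ε j * (H i k * H j k))))) ⟩
      sumFin (λ k → ε i * ε j * (H i k * H j k))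
        ≡⟨ sum-*ˡ (ε i * ε j) (λ k → H i k * H j k) ⟩
      ε i * ε j * (H ⊗ (H ᵗ)) i j
        ≡⟨ cong (ε i * ε j *_) (HHᵗ i j) ⟩
      ε i * ε j * scalarId (+ n) i j
        ≡⟨ absorb i j ⟩
      scalarId (+ n) i j ∎

  dot-resign : ∀ {n} (ε x y : Fin n → ℤ) H →
    dot x (resign ε H · y) ≡ dot (λ i → x i * ε i) (H · (λ j → ε j * y j))
  dot-resign ε x y H = sum-cong λ i → begin
    x i * sumFin (λ j → ε i * (H i j * ε j) * y j)
      ≡⟨ cong (x i *_) (trans (sum-cong λ j → e (ε i) (H i j) (ε j) (y j)) (sum-*ˡ (ε i) (λ j → H i j * (ε j * y j)))) ⟩
    x i * (ε i * (H · (λ j → ε j * y j)) i)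
      ≡⟨ ℤₚ.*-assoc (x i) (ε i) _ ⟨
    x i * ε i * (H · (λ j → ε j * y j)) i ∎
    where
    open ≡-Reasoning
    e : ∀ a b c d → a * (b * c) * d ≡ a * (b * (c * d))
    e = solve-∀

  -- The excess of any matrix equivalent to `resign ε H` is a value of the bilinear form of `H` at
  -- two sign vectors. So a bound on the form over all sign vectors, attained at `(ε, ε)`, is
  -- enough.
  maximalExcess : ∀ {n c} {H : Matrix n} {ε : Fin n → ℤ} → IsHadamard n H → (∀ i → IsSign (ε i)) →
    dot ε (H · ε) ≡ c →
    (∀ {x y : Fin n → ℤ} → (∀ i → IsSign (x i)) → (∀ i → IsSign (y i)) → dot x (H · y) ≤ c) →
    MaximalExcess n c
  maximalExcess {n} {c} {H} {ε} had sε attained bound = resign ε H , resign-hadamard sε had , exc , maximal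
    where
    exc : excess (resign ε H) ≡ c
    exc = trans (excess-ones (resign ε H)) (trans (dot-resign ε ones ones H)
      (trans (sum-cong λ i → cong₂ _*_ (ℤₚ.*-identityˡ (ε i))
               (sum-cong λ j → cong (H i j *_) (ℤₚ.*-identityʳ (ε j)))) attained))
    maximal : ∀ K → Equivalent n K (resign ε H) → excess K ≤ c
    maximal K (P , Q , sP , sQ , K≡) = subst (_≤ c)
      (sym (trans (sum-cong λ i → sum-cong λ j → K≡ i j)
           (trans (excess-⊗ P (resign ε H) Q) (dot-resign ε ((P ᵗ) · ones) (Q · ones) H))))
      (bound (λ i → sign-* (colSum-signedPerm sP i) (sε i)) (λ j → sign-* (sε j) (rowSum-signedPerm sQ j)))

  -- Matrices in block form and the doubled matrix

  blocks : ∀ {a n} → (Fin a × Fin n → Fin a × Fin n → ℤ) → Matrix (a ℕ.* n)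
  blocks {a} {n} f u v = f (remQuot {a} n u) (remQuot {a} n v)

  sum-remQuot₂ : ∀ {n} (f : Fin 2 × Fin n → ℤ) →
    sumFin (λ u → f (remQuot {2} n u)) ≡ sumFin (λ i → f (zero , i) + f (suc zero , i))
  sum-remQuot₂ f = trans (sum-remQuot 2 f)
    (trans (cong (_+_ (sumFin (λ i → f (zero , i)))) (ℤₚ.+-identityʳ _))
           (sym (sum-+ (λ i → f (zero , i)) (λ i → f (suc zero , i)))))

  remQuot-injective : ∀ {a} n {u v : Fin (a ℕ.* n)} → remQuot {a} n u ≡ remQuot {a} n v → u ≡ v
  remQuot-injective {a} n {u} {v} eq = trans (sym (combine-remQuot {a} n u))
    (trans (cong (λ (i , j) → combine i j) eq) (combine-remQuot {a} n v))

  -- The scalar matrix on pairs. Block numbers are compared first, so that it reduces as soon as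
  -- both blocks are known.
  pairId : ∀ {a n} → ℤ → Fin a × Fin n → Fin a × Fin n → ℤ
  pairId c (a , i) (b , j) with a ≟ b
  ... | yes _ = scalarId c i j
  ... | no  _ = 0ℤ

  scalarId-remQuot : ∀ {a n} c (u v : Fin (a ℕ.* n)) → scalarId c u v ≡ pairId c (remQuot {a} n u) (remQuot {a} n v)
  scalarId-remQuot {a} {n} c u v with proj₁ (remQuot {a} n u) ≟ proj₁ (remQuot {a} n v)
  ... | no  a≢b = scalarId-≢ c {u} {v} (a≢b ∘ cong (proj₁ ∘ remQuot {a} n))
  ... | yes a≡b with proj₂ (remQuot {a} n u) ≟ proj₂ (remQuot {a} n v)
  ...   | no  i≢j = scalarId-≢ c {u} {v} (i≢j ∘ cong (proj₂ ∘ remQuot {a} n))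
  ...   | yes i≡j with remQuot-injective {a} n {u} {v} (cong₂ _,_ a≡b i≡j)
  ...     | refl = scalarId-refl c u

  blocks₂-hadamard : ∀ {n} {f : Fin 2 × Fin n → Fin 2 × Fin n → ℤ} → (∀ x y → IsSign (f x y)) →
    (∀ x y → sumFin (λ k → f x (zero , k) * f y (zero , k) + f x (suc zero , k) * f y (suc zero , k)) ≡
             pairId (+ (2 ℕ.* n)) x y) →
    IsHadamard (2 ℕ.* n) (blocks f)
  blocks₂-hadamard {n} {f} sf orth = (λ u v → sf (remQuot n u) (remQuot n v)) , λ u v →
    trans (sum-remQuot₂ (λ z → f (remQuot n u) z * f (remQuot n v) z))
          (trans (orth (remQuot n u) (remQuot n v)) (sym (scalarId-remQuot {2} {n} (+ (2 ℕ.* n)) u v)))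

  blocks₂-· : ∀ {n} (f : Fin 2 × Fin n → Fin 2 × Fin n → ℤ) (v : Fin 2 × Fin n → ℤ) u →
    (blocks f · (v ∘ remQuot n)) u ≡
    sumFin (λ k → f (remQuot n u) (zero , k) * v (zero , k) + f (remQuot n u) (suc zero , k) * v (suc zero , k))
  blocks₂-· {n} f v u = sum-remQuot₂ (λ z → f (remQuot n u) z * v z)

  double : ∀ {k} → Matrix k → Fin 2 × Fin k → Fin 2 × Fin k → ℤ
  double K (suc zero , u) (suc zero , v) = - K u v
  double K (zero     , u) (_        , v) = K u v
  double K (suc zero , u) (zero     , v) = K u v

  +2*n : ∀ n → + (2 ℕ.* n) ≡ + 2 * + n
  +2*n n = ℤₚ.pos-* 2 n

  double-hadamard : ∀ {k} {K : Matrix k} → IsHadamard k K → IsHadamard (2 ℕ.* k) (blocks (double K))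
  double-hadamard {k} {K} (sK , KKᵗ) = blocks₂-hadamard signs orth
    where
    signs : ∀ x y → IsSign (double K x y)
    signs (suc zero , u) (suc zero , v) = sign-neg (sK u v)
    signs (zero     , u) (_        , v) = sK u v
    signs (suc zero , u) (zero     , v) = sK u v
    scale : ∀ u v → + 2 * scalarId (+ k) u v ≡ scalarId (+ (2 ℕ.* k)) u v
    scale u v with u ≟ v
    ... | yes _ = sym (+2*n k)
    ... | no  _ = refl
    diag : ∀ u v → sumFin (λ w → K u w * K v w + K u w * K v w) ≡ scalarId (+ (2 ℕ.* k)) u v
    diag u v = trans (sum-cong λ w → e (K u w * K v w)) (trans (sum-*ˡ (+ 2) (λ w → K u w * K v w))
      (trans (cong (+ 2 *_) (KKᵗ u v)) (scale u v)))
      where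
      e : ∀ a → a + a ≡ + 2 * a
      e = solve-∀
    orth : ∀ x y → sumFin (λ w → double K x (zero , w) * double K y (zero , w) +
                                 double K x (suc zero , w) * double K y (suc zero , w)) ≡ pairId (+ (2 ℕ.* k)) x y
    orth (zero , u) (zero , v) = diag u v
    orth (zero , u) (suc zero , v) = sum-zero λ w → e (K u w) (K v w)
      where
      e : ∀ a b → a * b + a * (- b) ≡ 0ℤ
      e = solve-∀
    orth (suc zero , u) (zero , v) = sum-zero λ w → e (K u w) (K v w)
      where
      e : ∀ a b → a * b + (- a) * b ≡ 0ℤ
      e = solve-∀
    orth (suc zero , u) (suc zero , v) = trans (sum-cong λ w → e (K u w) (K v w)) (diag u v)
      where
      e : ∀ a b → a * b + (- a) * (- b) ≡ a * b + a * b
      e = solve-∀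

  double-form : ∀ {k} (K : Matrix k) (x y : Fin (2 ℕ.* k) → ℤ) →
    let x₀ = x ∘ combine {2} zero; x₁ = x ∘ combine {2} (suc zero)
        y₀ = y ∘ combine {2} zero; y₁ = y ∘ combine {2} (suc zero) in
    dot x (blocks (double K) · y) ≡
    sumFin (λ u → x₀ u * ((K · y₀) u + (K · y₁) u) + x₁ u * ((K · y₀) u - (K · y₁) u))
  double-form {k} K x y = begin
    dot x (blocks (double K) · y)
      ≡⟨ sum-cong (λ u → cong₂ _*_ (via-remQuot x u)
           (trans (sum-cong λ v → cong (blocks (double K) u v *_) (via-remQuot y v))
                  (blocks₂-· (double K) (λ (b , v) → y (combine b v)) u))) ⟩
    sumFin (λ u → row (remQuot {2} k u))
      ≡⟨ sum-remQuot₂ row ⟩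
    sumFin (λ u → row (zero , u) + row (suc zero , u))
      ≡⟨ sum-cong (λ u → cong₂ (λ s t → x₀ u * s + x₁ u * t)
           (sum-+ (λ v → K u v * y₀ v) (λ v → K u v * y₁ v))
           (trans (sum-+ (λ v → K u v * y₀ v) (λ v → - K u v * y₁ v)) (cong (_+_ ((K · y₀) u))
             (trans (sum-cong λ v → e (K u v) (y₁ v)) (trans (sum-*ˡ (- 1ℤ) (λ v → K u v * y₁ v)) (ℤₚ.-1*i≡-i ((K · y₁) u))))))) ⟩
    sumFin (λ u → x₀ u * ((K · y₀) u + (K · y₁) u) + x₁ u * ((K · y₀) u - (K · y₁) u)) ∎
    where
    open ≡-Reasoning
    x₀ = x ∘ combine {2} zero
    x₁ = x ∘ combine {2} (suc zero)
    y₀ = y ∘ combine {2} zero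
    y₁ = y ∘ combine {2} (suc zero)
    via-remQuot : (z : Fin (2 ℕ.* k) → ℤ) → ∀ u → z u ≡ (λ (b , v) → z (combine b v)) (remQuot {2} k u)
    via-remQuot z u = cong z (sym (combine-remQuot {2} k u))
    row : Fin 2 × Fin k → ℤ
    row (a , u) = x (combine a u) * sumFin (λ v →
      double K (a , u) (zero , v) * y₀ v + double K (a , u) (suc zero , v) * y₁ v)
    e : ∀ a b → - a * b ≡ - 1ℤ * (a * b)
    e = solve-∀

  -- From a conference matrix to a Hadamard matrix

  -- A symmetric conference matrix that becomes regular, with all row sums `p`, when row `i` and
  -- column `i` are multiplied by `ζ i` for every `i`.
  record RegularConference (p m : ℕ) : Set where
    field
      C           : Matrix m
      symmetric   : IsSymmetric C
      diagonal    : ∀ i → C i i ≡ 0ℤ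
      offDiagonal : ∀ {i j} → i ≢ j → IsSign (C i j)
      square      : ∀ i j → (C ⊗ (C ᵗ)) i j ≡ scalarId (+ p * + p) i j
      ζ           : Fin m → ℤ
      ζ-sign      : ∀ i → IsSign (ζ i)
      eigen       : ∀ i → (C · ζ) i ≡ + p * ζ i

  δ : ∀ {n} → Matrix n
  δ = scalarId 1ℤ

  δ-symmetric : ∀ {n} → IsSymmetric (δ {n})
  δ-symmetric i j with i ≟ j
  ... | yes refl = sym (scalarId-refl 1ℤ i)
  ... | no  i≢j  = sym (scalarId-≢ 1ℤ (i≢j ∘ sym))

  scalarId-δ : ∀ {n} c (i j : Fin n) → scalarId c i j ≡ c * δ i j
  scalarId-δ c i j with i ≟ j
  ... | yes _ = sym (ℤₚ.*-identityʳ c)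
  ... | no  _ = sym (ℤₚ.*-zeroʳ c)

  sum-δˡ : ∀ {n} (i : Fin n) f → sumFin (λ k → δ i k * f k) ≡ f i
  sum-δˡ i f = trans (sum-scalarId 1ℤ i f) (ℤₚ.*-identityˡ (f i))

  module PaleyII {p m} (conf : RegularConference p m) (m≡ : + m ≡ 1ℤ + + p * + p) where
    open RegularConference conf

    paley : Fin 2 × Fin m → Fin 2 × Fin m → ℤ
    paley (zero     , i) (zero     , j) = C i j + δ i j
    paley (zero     , i) (suc zero , j) = C i j - δ i j
    paley (suc zero , i) (zero     , j) = C i j - δ i j
    paley (suc zero , i) (suc zero , j) = - C i j - δ i j

    K : Matrix (2 ℕ.* m)
    K = blocks paley

    -- Exactly one of `C i j` and `δ i j` is nonzero, and that one is a sign.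
    C±δ-sign : ∀ i j → IsSign (C i j + δ i j) × IsSign (C i j - δ i j)
    C±δ-sign i j with i ≟ j
    ... | yes refl rewrite diagonal i = inj₁ refl , inj₂ refl
    ... | no  i≢j  with C i j | offDiagonal i≢j
    ...   | _ | inj₁ refl = inj₁ refl , inj₁ refl
    ...   | _ | inj₂ refl = inj₂ refl , inj₂ refl

    paley-sign : ∀ x y → IsSign (paley x y)
    paley-sign (zero     , i) (zero     , j) = proj₁ (C±δ-sign i j)
    paley-sign (zero     , i) (suc zero , j) = proj₂ (C±δ-sign i j)
    paley-sign (suc zero , i) (zero     , j) = proj₂ (C±δ-sign i j)
    paley-sign (suc zero , i) (suc zero , j) =
      subst IsSign (ℤₚ.neg-distrib-+ (C i j) (δ i j)) (sign-neg (proj₁ (C±δ-sign i j)))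

    paley-symmetric : ∀ x y → paley x y ≡ paley y x
    paley-symmetric (zero     , i) (zero     , j) = cong₂ _+_ (symmetric i j) (δ-symmetric i j)
    paley-symmetric (zero     , i) (suc zero , j) = cong₂ _-_ (symmetric i j) (δ-symmetric i j)
    paley-symmetric (suc zero , i) (zero     , j) = cong₂ _-_ (symmetric i j) (δ-symmetric i j)
    paley-symmetric (suc zero , i) (suc zero , j) = cong₂ (λ c d → - c - d) (symmetric i j) (δ-symmetric i j)

    K-symmetric : IsSymmetric K
    K-symmetric u v = paley-symmetric (remQuot m u) (remQuot m v)

    K-order : + (2 ℕ.* m) ≡ + 2 * (1ℤ + + p * + p)
    K-order = trans (+2*n m) (cong (+ 2 *_) m≡)

    -- These are the cross terms between the two block rows of `paley`. The identity factors pick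
    -- out `C j i` and `C i j`, which cancel by symmetry.
    sum-mixed : ∀ i j → sumFin (λ k → δ i k * C j k - C i k * δ j k) ≡ 0ℤ
    sum-mixed i j = begin
      sumFin (λ k → δ i k * C j k - C i k * δ j k)
        ≡⟨ sum-cong (λ k → e (δ i k) (C j k) (C i k) (δ j k)) ⟩
      sumFin (λ k → δ i k * C j k + - 1ℤ * (δ j k * C i k))
        ≡⟨ sum-+ (λ k → δ i k * C j k) (λ k → - 1ℤ * (δ j k * C i k)) ⟩
      sumFin (λ k → δ i k * C j k) + sumFin (λ k → - 1ℤ * (δ j k * C i k))
        ≡⟨ cong₂ _+_ (sum-δˡ i (C j)) (trans (sum-*ˡ (- 1ℤ) (λ k → δ j k * C i k))
             (cong (- 1ℤ *_) (trans (sum-δˡ j (C i)) (symmetric i j)))) ⟩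
      C j i + - 1ℤ * C j i
        ≡⟨ e′ (C j i) ⟩
      0ℤ ∎
      where
      open ≡-Reasoning
      e : ∀ a b c d → a * b - c * d ≡ a * b + - 1ℤ * (d * c)
      e = solve-∀
      e′ : ∀ a → a + - 1ℤ * a ≡ 0ℤ
      e′ = solve-∀

    -- `C Cᵗ + I` is `(p² + 1) I`, and `2(p² + 1)` is the order of `K`.
    sum-square : ∀ i j → sumFin (λ k → + 2 * (C i k * C j k + δ i k * δ j k)) ≡ scalarId (+ (2 ℕ.* m)) i j
    sum-square i j = begin
      sumFin (λ k → + 2 * (C i k * C j k + δ i k * δ j k))
        ≡⟨ sum-*ˡ (+ 2) (λ k → C i k * C j k + δ i k * δ j k) ⟩
      + 2 * sumFin (λ k → C i k * C j k + δ i k * δ j k)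
        ≡⟨ cong (+ 2 *_) (sum-+ (λ k → C i k * C j k) (λ k → δ i k * δ j k)) ⟩
      + 2 * ((C ⊗ (C ᵗ)) i j + sumFin (λ k → δ i k * δ j k))
        ≡⟨ cong₂ (λ s t → + 2 * (s + t)) (trans (square i j) (scalarId-δ (+ p * + p) i j))
                                         (trans (sum-δˡ i (δ j)) (δ-symmetric j i)) ⟩
      + 2 * (+ p * + p * δ i j + δ i j)
        ≡⟨ e (+ p) (δ i j) ⟩
      + 2 * (1ℤ + + p * + p) * δ i j
        ≡⟨ cong (_* δ i j) K-order ⟨
      + (2 ℕ.* m) * δ i j
        ≡⟨ scalarId-δ (+ (2 ℕ.* m)) i j ⟨
      scalarId (+ (2 ℕ.* m)) i j ∎
      where
      open ≡-Reasoning
      e : ∀ p d → + 2 * (p * p * d + d) ≡ + 2 * (1ℤ + p * p) * d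
      e = solve-∀

    K-hadamard : IsHadamard (2 ℕ.* m) K
    K-hadamard = blocks₂-hadamard paley-sign orth
      where
      orth : ∀ x y → sumFin (λ k → paley x (zero , k) * paley y (zero , k) +
                                   paley x (suc zero , k) * paley y (suc zero , k)) ≡ pairId (+ (2 ℕ.* m)) x y
      orth (zero , i) (zero , j) = trans (sum-cong λ k → e (C i k) (δ i k) (C j k) (δ j k)) (sum-square i j)
        where
        e : ∀ c d c′ d′ → (c + d) * (c′ + d′) + (c - d) * (c′ - d′) ≡ + 2 * (c * c′ + d * d′)
        e = solve-∀
      orth (suc zero , i) (suc zero , j) = trans (sum-cong λ k → e (C i k) (δ i k) (C j k) (δ j k)) (sum-square i j)
        where
        e : ∀ c d c′ d′ → (c - d) * (c′ - d′) + (- c - d) * (- c′ - d′) ≡ + 2 * (c * c′ + d * d′)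
        e = solve-∀
      orth (zero , i) (suc zero , j) = trans (sum-cong λ k → e (C i k) (δ i k) (C j k) (δ j k))
        (trans (sum-*ˡ (+ 2) (λ k → δ i k * C j k - C i k * δ j k)) (cong (+ 2 *_) (sum-mixed i j)))
        where
        e : ∀ c d c′ d′ → (c + d) * (c′ - d′) + (c - d) * (- c′ - d′) ≡ + 2 * (d * c′ - c * d′)
        e = solve-∀
      orth (suc zero , i) (zero , j) = trans (sum-cong λ k → e (C i k) (δ i k) (C j k) (δ j k))
        (trans (sum-*ˡ (- + 2) (λ k → δ i k * C j k - C i k * δ j k)) (cong (- + 2 *_) (sum-mixed i j)))
        where
        e : ∀ c d c′ d′ → (c - d) * (c′ + d′) + (- c - d) * (c′ - d′) ≡ - + 2 * (d * c′ - c * d′)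
        e = solve-∀

    -- K η and K θ interchange the large entries ± 2 p and the small entries ± 2, so one of the two is large in every row.
    η θ : Fin 2 × Fin m → ℤ
    η (_        , i) = ζ i
    θ (zero     , i) = ζ i
    θ (suc zero , i) = - ζ i

    η-sign : ∀ x → IsSign (η x)
    η-sign (_ , i) = ζ-sign i

    θ-sign : ∀ x → IsSign (θ x)
    θ-sign (zero     , i) = ζ-sign i
    θ-sign (suc zero , i) = sign-neg (ζ-sign i)

    sum-Cδ : ∀ a b i → sumFin (λ k → a * (C i k * ζ k) + b * (δ i k * ζ k)) ≡ (a * + p + b) * ζ i
    sum-Cδ a b i = begin
      sumFin (λ k → a * (C i k * ζ k) + b * (δ i k * ζ k))
        ≡⟨ sum-+ (λ k → a * (C i k * ζ k)) (λ k → b * (δ i k * ζ k)) ⟩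
      sumFin (λ k → a * (C i k * ζ k)) + sumFin (λ k → b * (δ i k * ζ k))
        ≡⟨ cong₂ _+_ (trans (sum-*ˡ a (λ k → C i k * ζ k)) (cong (a *_) (eigen i)))
                     (trans (sum-*ˡ b (λ k → δ i k * ζ k)) (cong (b *_) (sum-δˡ i ζ))) ⟩
      a * (+ p * ζ i) + b * ζ i
        ≡⟨ e a (+ p) b (ζ i) ⟩
      (a * + p + b) * ζ i ∎
      where
      open ≡-Reasoning
      e : ∀ a p b z → a * (p * z) + b * z ≡ (a * p + b) * z
      e = solve-∀

    -- The coefficients are kept in the shape `a * p + b` in which `sum-Cδ` gives the action of
    -- `a C + b I` on the eigenvector `ζ`.
    Kη Kθ : Fin 2 × Fin m → ℤ
    Kη (zero     , i) = (+ 2 * + p + 0ℤ) * ζ i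
    Kη (suc zero , i) = (0ℤ * + p + - + 2) * ζ i
    Kθ (zero     , i) = (0ℤ * + p + + 2) * ζ i
    Kθ (suc zero , i) = (+ 2 * + p + 0ℤ) * ζ i

    K·η : ∀ x → sumFin (λ k → paley x (zero , k) * η (zero , k) + paley x (suc zero , k) * η (suc zero , k)) ≡ Kη x
    K·η (zero , i) = trans (sum-cong λ k → e (C i k) (δ i k) (ζ k)) (sum-Cδ (+ 2) 0ℤ i)
      where
      e : ∀ c d z → (c + d) * z + (c - d) * z ≡ + 2 * (c * z) + 0ℤ * (d * z)
      e = solve-∀
    K·η (suc zero , i) = trans (sum-cong λ k → e (C i k) (δ i k) (ζ k)) (sum-Cδ 0ℤ (- + 2) i)
      where
      e : ∀ c d z → (c - d) * z + (- c - d) * z ≡ 0ℤ * (c * z) + - + 2 * (d * z)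
      e = solve-∀

    K·θ : ∀ x → sumFin (λ k → paley x (zero , k) * θ (zero , k) + paley x (suc zero , k) * θ (suc zero , k)) ≡ Kθ x
    K·θ (zero , i) = trans (sum-cong λ k → e (C i k) (δ i k) (ζ k)) (sum-Cδ 0ℤ (+ 2) i)
      where
      e : ∀ c d z → (c + d) * z + (c - d) * (- z) ≡ 0ℤ * (c * z) + + 2 * (d * z)
      e = solve-∀
    K·θ (suc zero , i) = trans (sum-cong λ k → e (C i k) (δ i k) (ζ k)) (sum-Cδ (+ 2) 0ℤ i)
      where
      e : ∀ c d z → (c - d) * z + (- c - d) * (- z) ≡ + 2 * (c * z) + 0ℤ * (d * z)
      e = solve-∀

    ε-pair : Fin 2 × Fin (2 ℕ.* m) → ℤ
    ε-pair (zero     , u) = η (remQuot m u)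
    ε-pair (suc zero , u) = θ (remQuot m u)

    ε : Fin (2 ℕ.* (2 ℕ.* m)) → ℤ
    ε = ε-pair ∘ remQuot (2 ℕ.* m)

    ε-sign : ∀ u → IsSign (ε u)
    ε-sign u = pair-sign (remQuot (2 ℕ.* m) u)
      where
      pair-sign : ∀ x → IsSign (ε-pair x)
      pair-sign (zero     , u) = η-sign (remQuot m u)
      pair-sign (suc zero , u) = θ-sign (remQuot m u)

    -- In the first block `η = θ = ζ`, so the row term is `2 ζ Kη = 4p`; in the second `θ = - ζ`, so
    -- it is `2 ζ Kθ = 4p`. Thus each of the `1 + p²` indices of `C` contributes `8p`.
    excess-attained : dot ε (blocks (double K) · ε) ≡ + 8 * + p * (1ℤ + + p * + p)
    excess-attained = begin
      dot ε (blocks (double K) · ε)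
        ≡⟨ double-form K ε ε ⟩
      sumFin (λ u → ε₀ u * ((K · ε₀) u + (K · ε₁) u) + ε₁ u * ((K · ε₀) u - (K · ε₁) u))
        ≡⟨ sum-cong (λ u → value u (ε₀≡ u) (ε₁≡ u) (K·ε₀ u) (K·ε₁ u)) ⟩
      sumFin (λ u → row (remQuot {2} m u))
        ≡⟨ sum-remQuot₂ row ⟩
      sumFin (λ i → row (zero , i) + row (suc zero , i))
        ≡⟨ sum-cong (λ i → trans (e (+ p) (ζ i)) (cong (+ 8 * + p *_) (sign-square (ζ-sign i)))) ⟩
      sumFin {m} (λ i → + 8 * + p * 1ℤ)
        ≡⟨ sum-const m (+ 8 * + p * 1ℤ) ⟩
      + m * (+ 8 * + p * 1ℤ)
        ≡⟨ cong (_* (+ 8 * + p * 1ℤ)) m≡ ⟩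
      (1ℤ + + p * + p) * (+ 8 * + p * 1ℤ)
        ≡⟨ e′ (+ p) ⟩
      + 8 * + p * (1ℤ + + p * + p) ∎
      where
      open ≡-Reasoning
      ε₀ ε₁ : Fin (2 ℕ.* m) → ℤ
      ε₀ = ε ∘ combine {2} zero
      ε₁ = ε ∘ combine {2} (suc zero)
      ε₀≡ : ∀ u → ε₀ u ≡ η (remQuot m u)
      ε₀≡ u = cong ε-pair (remQuot-combine {2} zero u)
      ε₁≡ : ∀ u → ε₁ u ≡ θ (remQuot m u)
      ε₁≡ u = cong ε-pair (remQuot-combine {2} (suc zero) u)
      K·ε₀ : ∀ u → (K · ε₀) u ≡ Kη (remQuot m u)
      K·ε₀ u = trans (sum-cong λ v → cong (K u v *_) (ε₀≡ v)) (trans (blocks₂-· paley η u) (K·η (remQuot m u)))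
      K·ε₁ : ∀ u → (K · ε₁) u ≡ Kθ (remQuot m u)
      K·ε₁ u = trans (sum-cong λ v → cong (K u v *_) (ε₁≡ v)) (trans (blocks₂-· paley θ u) (K·θ (remQuot m u)))
      row : Fin 2 × Fin m → ℤ
      row x = η x * (Kη x + Kθ x) + θ x * (Kη x - Kθ x)
      value : ∀ u {a b c d} → a ≡ η (remQuot m u) → b ≡ θ (remQuot m u) →
        c ≡ Kη (remQuot m u) → d ≡ Kθ (remQuot m u) →
        a * (c + d) + b * (c - d) ≡ row (remQuot m u)
      value u refl refl refl refl = refl
      e : ∀ p z →
        (z * ((+ 2 * p + 0ℤ) * z + (0ℤ * p + + 2) * z) + z * ((+ 2 * p + 0ℤ) * z - (0ℤ * p + + 2) * z)) +
        (z * ((0ℤ * p + - + 2) * z + (+ 2 * p + 0ℤ) * z) + (- z) * ((0ℤ * p + - + 2) * z - (+ 2 * p + 0ℤ) * z))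
        ≡ + 8 * p * (z * z)
      e = solve-∀
      e′ : ∀ p → (1ℤ + p * p) * (+ 8 * p * 1ℤ) ≡ + 8 * p * (1ℤ + p * p)
      e′ = solve-∀

  conference⇒maximalExcess : ∀ n {m} → Odd (+ suc (suc n)) → RegularConference (suc (suc n)) m →
    + m ≡ 1ℤ + + suc (suc n) * + suc (suc n) →
    MaximalExcess (2 ℕ.* (2 ℕ.* m)) (+ 8 * + suc (suc n) * (1ℤ + + suc (suc n) * + suc (suc n)))
  conference⇒maximalExcess n {m} p-odd conf m≡ =
    maximalExcess {H = blocks (double K)} (double-hadamard K-hadamard) ε-sign excess-attained
      λ {x} {y} sx sy → subst (_≤ + 8 * + suc (suc n) * (1ℤ + + suc (suc n) * + suc (suc n)))
        (sym (double-form K x y))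
        (doubled-bound n p-odd K-order K-hadamard K-symmetric
          (sx ∘ combine {2} zero) (sx ∘ combine {2} (suc zero))
          (sy ∘ combine {2} zero) (sy ∘ combine {2} (suc zero)))
    where open PaleyII conf m≡

  -- Lines of the affine plane over ℤ/p

  -- One sign pattern serves twice: negated, it gives the signs of the directions `suc s`; along the
  -- first coordinate, it gives the eigenvector `ζ`.
  alternating : ∀ {n} → Fin n → ℤ
  alternating zero    = 1ℤ
  alternating (suc i) = - alternating i

  alternating-sign : ∀ {n} (i : Fin n) → IsSign (alternating i)
  alternating-sign zero    = inj₁ refl
  alternating-sign (suc i) = sign-neg (alternating-sign i)

  sum-alternating : ∀ n → ¬ 2 ℕᵈ.∣ n → sumFin {n} alternating ≡ 1ℤ
  sum-alternating zero          2∤n = contradiction (2 ℕᵈ.∣0) 2∤n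
  sum-alternating (suc zero)    2∤n = refl
  sum-alternating (suc (suc n)) 2∤n = trans (e (sumFin {n} (λ i → - - alternating i)))
    (trans (sum-cong {n} λ i → ℤₚ.neg-involutive (alternating i))
           (sum-alternating n (2∤n ∘ ℕᵈ.∣m∣n⇒∣m+n ℕᵈ.∣-refl)))
    where
    e : ∀ s → 1ℤ + (- 1ℤ + s) ≡ s
    e = solve-∀

  sum-product : ∀ {l m n} (F : Fin m → Fin l → ℤ) (G : Fin n → Fin l → ℤ) →
    sumFin (λ w → sumFin (λ d → F d w) * sumFin (λ d′ → G d′ w)) ≡
    sumFin (λ d → sumFin (λ d′ → sumFin (λ w → F d w * G d′ w)))
  sum-product F G = begin
    sumFin (λ w → sumFin (λ d → F d w) * sumFin (λ d′ → G d′ w))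
      ≡⟨ sum-cong (λ w → trans (sym (sum-*ʳ (sumFin (λ d′ → G d′ w)) (λ d → F d w)))
           (sum-cong λ d → sym (sum-*ˡ (F d w) (λ d′ → G d′ w)))) ⟩
    sumFin (λ w → sumFin (λ d → sumFin (λ d′ → F d w * G d′ w)))
      ≡⟨ sum-swap (λ w d → sumFin (λ d′ → F d w * G d′ w)) ⟩
    sumFin (λ d → sumFin (λ w → sumFin (λ d′ → F d w * G d′ w)))
      ≡⟨ sum-cong (λ d → sum-swap (λ w d′ → F d w * G d′ w)) ⟩
    sumFin (λ d → sumFin (λ d′ → sumFin (λ w → F d w * G d′ w))) ∎
    where open ≡-Reasoning

  indicator : ∀ {P : Set} → Dec P → ℤ
  indicator (yes _) = 1ℤ
  indicator (no  _) = 0ℤ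

  indicator-yes : ∀ {P : Set} (P? : Dec P) → P → indicator P? ≡ 1ℤ
  indicator-yes (yes _) _ = refl
  indicator-yes (no ¬P) P = contradiction P ¬P

  indicator-no : ∀ {P : Set} (P? : Dec P) → ¬ P → indicator P? ≡ 0ℤ
  indicator-no (yes P) ¬P = contradiction P ¬P
  indicator-no (no _)  _  = refl

  module AffinePlane {p : ℕ} (p-prime : Prime p) where

    private instance
      p≢0 : ℕ.NonZero p
      p≢0 = prime⇒nonZero p-prime

    -- Residues and linear congruences modulo p

    ⟦_⟧ : Fin p → ℤ
    ⟦ a ⟧ = + toℕ a

    -- Two representatives below `p` differ by less than `p`, so a multiple of `p` between them must
    -- be zero.
    ⟦⟧-injective : ∀ {a b} → + p ∣ ⟦ a ⟧ - ⟦ b ⟧ → a ≡ b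
    ⟦⟧-injective {a} {b} p∣a-b = toℕ-injective (ℤₚ.+-injective (ℤₚ.i-j≡0⇒i≡j ⟦ a ⟧ ⟦ b ⟧
      (ℤₚ.∣i∣≡0⇒i≡0 (small (∣⇒∣ᵤ p∣a-b) (subst (ℕ._< p) (cong ∣_∣ (sym (ℤₚ.[+m]-[+n]≡m⊖n (toℕ a) (toℕ b))))
        (ℕₚ.≤-<-trans (ℤₚ.∣m⊝n∣≤m⊔n (toℕ a) (toℕ b)) (ℕₚ.⊔-lub (toℕ<n a) (toℕ<n b))))))))
      where
      small : ∀ {n} → p ℕᵈ.∣ n → n ℕ.< p → n ≡ 0
      small {zero}  _   _   = refl
      small {suc n} p∣n n<p = contradiction p∣n (ℕᵈ.>⇒∤ n<p)

    opaque
      residue : ∀ e → ∃ λ (r : Fin p) → + p ∣ ⟦ r ⟧ - e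
      residue e = fromℕ< (n%ℕd<d e p) , divides (- (e /ℕ p)) (trans
        (cong₂ _-_ (cong +_ (toℕ-fromℕ< (n%ℕd<d e p))) (a≡a%ℕn+[a/ℕn]*n e p)) (lemma (+ (e %ℕ p)) (e /ℕ p) (+ p)))
        where
        lemma : ∀ r q p → r - (r + q * p) ≡ - q * p
        lemma = solve-∀

    opaque
      inverse-ℕ : ∀ k → ¬ p ℕᵈ.∣ k → ∃ λ x → + p ∣ + k * x - 1ℤ
      inverse-ℕ k p∤k with coprime-Bézout coprime
        where
        coprime : Coprime p k
        coprime (d∣p , d∣k) with prime⇒irreducible p-prime d∣p
        ... | inj₁ d≡1  = d≡1
        ... | inj₂ refl = contradiction d∣k p∤k
      -- Here Bézout gives `1 + y * k ≡ x * p`, so the inverse of `k` is `- y`; in the other case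
      -- `1 + x * p ≡ y * k` and it is `y`.
      ... | Bézout.+- x y eq = - + y , divides (- + x) (begin
              + k * - + y - 1ℤ     ≡⟨ e (+ k) (+ y) ⟩
              - (1ℤ + + y * + k)   ≡⟨ cong (λ t → - (1ℤ + t)) (ℤₚ.pos-* y k) ⟨
              - + (1 ℕ.+ y ℕ.* k)  ≡⟨ cong (λ t → - + t) eq ⟩
              - + (x ℕ.* p)        ≡⟨ cong -_ (ℤₚ.pos-* x p) ⟩
              - (+ x * + p)        ≡⟨ ℤₚ.neg-distribˡ-* (+ x) (+ p) ⟩
              - + x * + p          ∎)
        where
        open ≡-Reasoning
        e : ∀ k y → k * - y - 1ℤ ≡ - (1ℤ + y * k)
        e = solve-∀
      ... | Bézout.-+ x y eq = + y , divides (+ x) (begin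
              + k * + y - 1ℤ            ≡⟨ cong (_- 1ℤ) (ℤₚ.*-comm (+ k) (+ y)) ⟩
              + y * + k - 1ℤ            ≡⟨ cong (_- 1ℤ) (ℤₚ.pos-* y k) ⟨
              + (y ℕ.* k) - 1ℤ          ≡⟨ cong (λ t → + t - 1ℤ) eq ⟨
              1ℤ + + (x ℕ.* p) - 1ℤ     ≡⟨ e (+ (x ℕ.* p)) ⟩
              + (x ℕ.* p)               ≡⟨ ℤₚ.pos-* x p ⟩
              + x * + p                 ∎)
        where
        open ≡-Reasoning
        e : ∀ z → 1ℤ + z - 1ℤ ≡ z
        e = solve-∀

    inverse : ∀ c → ¬ + p ∣ c → ∃ λ x → + p ∣ c * x - 1ℤ
    inverse c p∤c with inverse-ℕ ∣ c ∣ (p∤c ∘ ∣ᵤ⇒∣) | ℤₚ.+∣i∣≡i⊎+∣i∣≡-i c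
    ... | x , p∣ | inj₁ ∣c∣≡c  = x , subst (λ k → + p ∣ k * x - 1ℤ) ∣c∣≡c p∣
    ... | x , p∣ | inj₂ ∣c∣≡-c = - x , subst (+ p ∣_) (trans (cong (λ k → k * x - 1ℤ) ∣c∣≡-c) (e c x)) p∣
      where
      e : ∀ c x → - c * x - 1ℤ ≡ c * - x - 1ℤ
      e = solve-∀

    ∣-difference : ∀ {x y z} → + p ∣ x → + p ∣ y → x - y ≡ z → + p ∣ z
    ∣-difference p∣x p∣y eq = subst (+ p ∣_) eq (∣m∣n⇒∣m-n p∣x p∣y)

    cancel : ∀ c {z} → ¬ + p ∣ c → + p ∣ c * z → + p ∣ z
    cancel c {z} p∤c p∣cz with euclidsLemma ∣ c ∣ ∣ z ∣ p-prime (subst (p ℕᵈ.∣_) (ℤₚ.abs-* c z) (∣⇒∣ᵤ p∣cz))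
    ... | inj₁ p∣c = contradiction (∣ᵤ⇒∣ p∣c) p∤c
    ... | inj₂ p∣z = ∣ᵤ⇒∣ p∣z

    opaque
      linear-congruence : ∀ c e → ¬ + p ∣ c →
        ∃ λ a₀ → + p ∣ c * ⟦ a₀ ⟧ - e × (∀ a → + p ∣ c * ⟦ a ⟧ - e → a ≡ a₀)
      linear-congruence c e p∤c with inverse c p∤c
      ... | x , p∣cx-1 with residue (x * e)
      ...   | a₀ , p∣a₀-xe = a₀ , root , unique
        where
        lemma₁ : ∀ c a x e → c * (a - x * e) - - e * (c * x - 1ℤ) ≡ c * a - e
        lemma₁ = solve-∀
        lemma₂ : ∀ c a b e → (c * a - e) - (c * b - e) ≡ c * (a - b)
        lemma₂ = solve-∀
        root : + p ∣ c * ⟦ a₀ ⟧ - e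
        root = ∣-difference (∣n⇒∣m*n c p∣a₀-xe) (∣n⇒∣m*n (- e) p∣cx-1) (lemma₁ c ⟦ a₀ ⟧ x e)
        unique : ∀ a → + p ∣ c * ⟦ a ⟧ - e → a ≡ a₀
        unique a p∣ = ⟦⟧-injective (cancel c p∤c (∣-difference p∣ root (lemma₂ c ⟦ a ⟧ ⟦ a₀ ⟧ e)))

    opaque
      -- The indicator of the zero class modulo `p`, with integer values so that counts of points
      -- become sums.
      χ : ℤ → ℤ
      χ z = indicator (+ p ∣? z)

      χ-yes : ∀ {z} → + p ∣ z → χ z ≡ 1ℤ
      χ-yes {z} = indicator-yes (+ p ∣? z)

      χ-no : ∀ {z} → ¬ + p ∣ z → χ z ≡ 0ℤ
      χ-no {z} = indicator-no (+ p ∣? z)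

    χ-equal : ∀ {z w} → (+ p ∣ z → + p ∣ w) → (+ p ∣ w → + p ∣ z) → χ z ≡ χ w
    χ-equal {z} {w} to from = by (+ p ∣? z)
      where
      by : Dec (+ p ∣ z) → χ z ≡ χ w
      by (yes p∣z) = trans (χ-yes p∣z) (sym (χ-yes (to p∣z)))
      by (no  p∤z) = trans (χ-no p∤z) (sym (χ-no (p∤z ∘ from)))

    χ-cong : ∀ {z w} → + p ∣ z - w → χ z ≡ χ w
    χ-cong {z} {w} p∣z-w = χ-equal (λ p∣z → ∣-difference p∣z p∣z-w (e₁ z w))
      (λ p∣w → subst (+ p ∣_) (e₂ z w) (∣m∣n⇒∣m+n p∣z-w p∣w))
      where
      e₁ : ∀ z w → z - (z - w) ≡ w
      e₁ = solve-∀
      e₂ : ∀ z w → z - w + w ≡ z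
      e₂ = solve-∀

    χ-neg : ∀ {z w} → - z ≡ w → χ z ≡ χ w
    χ-neg {z} refl = χ-equal ∣m⇒∣-m (λ p∣-z → subst (+ p ∣_) (ℤₚ.neg-involutive z) (∣m⇒∣-m p∣-z))

    χ-zero : ∀ {z} → z ≡ 0ℤ → χ z ≡ 1ℤ
    χ-zero z≡0 = χ-yes (divides 0ℤ (trans z≡0 (sym (ℤₚ.*-zeroˡ (+ p)))))

    sum-residue : ∀ e r → + p ∣ ⟦ r ⟧ - e → (g : Fin p → ℤ) → sumFin (λ b → χ (⟦ b ⟧ - e) * g b) ≡ g r
    sum-residue e r p∣r-e g = trans
      (sum-single r λ b b≢r → trans (cong (_* g b) (χ-no λ p∣b-e →
          b≢r (⟦⟧-injective (∣-difference p∣b-e p∣r-e (lemma ⟦ b ⟧ ⟦ r ⟧ e))))) (ℤₚ.*-zeroˡ (g b)))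
      (trans (cong (_* g r) (χ-yes p∣r-e)) (ℤₚ.*-identityˡ (g r)))
      where
      lemma : ∀ b r e → (b - e) - (r - e) ≡ b - r
      lemma = solve-∀

    sum-χ : ∀ e → sumFin (λ b → χ (⟦ b ⟧ - e)) ≡ 1ℤ
    sum-χ e = by (residue e)
      where
      by : (∃ λ r → + p ∣ ⟦ r ⟧ - e) → sumFin (λ b → χ (⟦ b ⟧ - e)) ≡ 1ℤ
      by (r , p∣r-e) = trans (sum-cong λ b → sym (ℤₚ.*-identityʳ (χ (⟦ b ⟧ - e))))
                             (sum-residue e r p∣r-e (λ _ → 1ℤ))

    -- Only the residue of `e` survives the first factor, and there the second factor tests whether
    -- `e` and `f` are congruent.
    sum-χ-χ : ∀ e f → sumFin (λ b → χ (⟦ b ⟧ - e) * χ (⟦ b ⟧ - f)) ≡ χ (e - f)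
    sum-χ-χ e f = by (residue e)
      where
      lemma : ∀ r e f → r - e ≡ (r - f) - (e - f)
      lemma = solve-∀
      by : (∃ λ r → + p ∣ ⟦ r ⟧ - e) → sumFin (λ b → χ (⟦ b ⟧ - e) * χ (⟦ b ⟧ - f)) ≡ χ (e - f)
      by (r , p∣r-e) = trans (sum-residue e r p∣r-e (λ b → χ (⟦ b ⟧ - f)))
                             (χ-cong (subst (+ p ∣_) (lemma ⟦ r ⟧ e f) p∣r-e))

    sum-χ-linear : ∀ c e → ¬ + p ∣ c → sumFin (λ a → χ (c * ⟦ a ⟧ - e)) ≡ 1ℤ
    sum-χ-linear c e p∤c with linear-congruence c e p∤c
    ... | a₀ , root , unique = trans (sum-single a₀ λ a a≢a₀ → χ-no (a≢a₀ ∘ unique a)) (χ-yes root)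

    -- Points, lines and incidence

    Point : Set
    Point = Fin p × Fin p

    -- Direction zero has the lines a = const, direction suc s the lines b + s a = const.
    line : Fin (suc p) → Point → ℤ
    line zero    (a , b) = ⟦ a ⟧
    line (suc s) (a , b) = ⟦ b ⟧ + ⟦ s ⟧ * ⟦ a ⟧

    -- Tests whether `v` lies on the line of direction `d` through `u`.
    incident : Fin (suc p) → Point → Point → ℤ
    incident d u v = χ (line d v - line d u)

    incident-symmetric : ∀ d u v → incident d u v ≡ incident d v u
    incident-symmetric d u v = χ-neg (e (line d u) (line d v))
      where
      e : ∀ x y → - (y - x) ≡ x - y
      e = solve-∀

    incident-refl : ∀ d u → incident d u u ≡ 1ℤ
    incident-refl d u = χ-zero (ℤₚ.+-inverseʳ (line d u))

    sum-points : (Point → ℤ) → ℤ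
    sum-points f = sumFin (λ a → sumFin (λ b → f (a , b)))

    shear : ∀ s (a b : Fin p) e → ⟦ b ⟧ + ⟦ s ⟧ * ⟦ a ⟧ - e ≡ ⟦ b ⟧ - (e - ⟦ s ⟧ * ⟦ a ⟧)
    shear s a b e = lemma ⟦ s ⟧ ⟦ a ⟧ ⟦ b ⟧ e
      where
      lemma : ∀ s a b e → b + s * a - e ≡ b - (e - s * a)
      lemma = solve-∀

    sum-shear : ∀ s a e → sumFin (λ b → χ (⟦ b ⟧ + ⟦ s ⟧ * ⟦ a ⟧ - e)) ≡ 1ℤ
    sum-shear s a e = trans (sum-cong λ b → cong χ (shear s a b e)) (sum-χ (e - ⟦ s ⟧ * ⟦ a ⟧))

    line-size : ∀ d e → sum-points (λ w → χ (line d w - e)) ≡ + p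
    line-size zero e = trans (sum-cong λ a → sum-const p (χ (⟦ a ⟧ - e)))
      (trans (sum-*ˡ (+ p) (λ a → χ (⟦ a ⟧ - e))) (trans (cong (+ p *_) (sum-χ e)) (ℤₚ.*-identityʳ (+ p))))
    line-size (suc s) e = trans (sum-cong λ a → sum-shear s a e) (trans (sum-const p 1ℤ) (ℤₚ.*-identityʳ (+ p)))

    -- A line of direction `suc s` has exactly one point over each first coordinate.
    sum-line-function : ∀ s e (g : Fin p → ℤ) →
      sum-points (λ w → χ (line (suc s) w - e) * g (proj₁ w)) ≡ sumFin g
    sum-line-function s e g = sum-cong λ a → trans (sum-*ʳ (g a) (λ b → χ (⟦ b ⟧ + ⟦ s ⟧ * ⟦ a ⟧ - e)))
      (trans (cong (_* g a) (sum-shear s a e)) (ℤₚ.*-identityˡ (g a)))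

    -- Lines of different directions meet in one point; lines of the same direction share all `p`
    -- points or none. The factor `δ d d′` puts both cases into one formula that can be summed over
    -- pairs of directions.
    intersection : ∀ d d′ e e′ → sum-points (λ w → χ (line d w - e) * χ (line d′ w - e′)) ≡
      1ℤ + δ d d′ * (+ p * χ (e - e′) - 1ℤ)
    intersection zero zero e e′ = begin
      sumFin (λ a → sumFin {p} (λ b → χ (⟦ a ⟧ - e) * χ (⟦ a ⟧ - e′)))
        ≡⟨ sum-cong (λ a → sum-const p (χ (⟦ a ⟧ - e) * χ (⟦ a ⟧ - e′))) ⟩
      sumFin (λ a → + p * (χ (⟦ a ⟧ - e) * χ (⟦ a ⟧ - e′)))
        ≡⟨ sum-*ˡ (+ p) (λ a → χ (⟦ a ⟧ - e) * χ (⟦ a ⟧ - e′)) ⟩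
      + p * sumFin (λ a → χ (⟦ a ⟧ - e) * χ (⟦ a ⟧ - e′))
        ≡⟨ cong (+ p *_) (sum-χ-χ e e′) ⟩
      + p * χ (e - e′)
        ≡⟨ lemma (+ p * χ (e - e′)) ⟩
      1ℤ + 1ℤ * (+ p * χ (e - e′) - 1ℤ) ∎
      where
      open ≡-Reasoning
      lemma : ∀ x → x ≡ 1ℤ + 1ℤ * (x - 1ℤ)
      lemma = solve-∀
    intersection zero (suc t) e e′ = begin
      sumFin (λ a → sumFin (λ b → χ (⟦ a ⟧ - e) * χ (line (suc t) (a , b) - e′)))
        ≡⟨ sum-cong (λ a → sum-*ˡ (χ (⟦ a ⟧ - e)) (λ b → χ (line (suc t) (a , b) - e′))) ⟩
      sumFin (λ a → χ (⟦ a ⟧ - e) * sumFin (λ b → χ (line (suc t) (a , b) - e′)))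
        ≡⟨ sum-cong (λ a → trans (cong (χ (⟦ a ⟧ - e) *_) (sum-shear t a e′)) (ℤₚ.*-identityʳ (χ (⟦ a ⟧ - e)))) ⟩
      sumFin (λ a → χ (⟦ a ⟧ - e))
        ≡⟨ sum-χ e ⟩
      1ℤ
        ≡⟨ cong (_+_ 1ℤ) (ℤₚ.*-zeroˡ (+ p * χ (e - e′) - 1ℤ)) ⟨
      1ℤ + 0ℤ * (+ p * χ (e - e′) - 1ℤ) ∎
      where open ≡-Reasoning
    intersection (suc s) zero e e′ = begin
      sumFin (λ a → sumFin (λ b → χ (line (suc s) (a , b) - e) * χ (⟦ a ⟧ - e′)))
        ≡⟨ sum-line-function s e (λ a → χ (⟦ a ⟧ - e′)) ⟩
      sumFin (λ a → χ (⟦ a ⟧ - e′))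
        ≡⟨ sum-χ e′ ⟩
      1ℤ
        ≡⟨ cong (_+_ 1ℤ) (ℤₚ.*-zeroˡ (+ p * χ (e - e′) - 1ℤ)) ⟨
      1ℤ + 0ℤ * (+ p * χ (e - e′) - 1ℤ) ∎
      where open ≡-Reasoning
    intersection (suc s) (suc t) e e′ = trans (sum-cong λ a → fibre a) (total (s ≟ t))
      where
      lemma : ∀ s t a e e′ → (e - s * a) - (e′ - t * a) ≡ (t - s) * a - (e′ - e)
      lemma = solve-∀
      -- Each line has one point over `a`, and the two points agree when `(t - s) a` is congruent to
      -- `e′ - e`. A single `a` solves this if `s ≢ t`; if `s ≡ t`, the condition does not depend on
      -- `a`.
      fibre : ∀ a → sumFin (λ b → χ (line (suc s) (a , b) - e) * χ (line (suc t) (a , b) - e′)) ≡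
                    χ ((⟦ t ⟧ - ⟦ s ⟧) * ⟦ a ⟧ - (e′ - e))
      fibre a = trans (sum-cong λ b → cong₂ (λ x y → χ x * χ y) (shear s a b e) (shear t a b e′))
        (trans (sum-χ-χ (e - ⟦ s ⟧ * ⟦ a ⟧) (e′ - ⟦ t ⟧ * ⟦ a ⟧)) (cong χ (lemma ⟦ s ⟧ ⟦ t ⟧ ⟦ a ⟧ e e′)))
      total : Dec (s ≡ t) → sumFin (λ a → χ ((⟦ t ⟧ - ⟦ s ⟧) * ⟦ a ⟧ - (e′ - e))) ≡
                            1ℤ + δ (suc s) (suc t) * (+ p * χ (e - e′) - 1ℤ)
      total (yes refl) = begin
        sumFin (λ a → χ ((⟦ s ⟧ - ⟦ s ⟧) * ⟦ a ⟧ - (e′ - e)))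
          ≡⟨ sum-cong (λ a → cong χ (lemma₁ ⟦ s ⟧ ⟦ a ⟧ e e′)) ⟩
        sumFin {p} (λ a → χ (e - e′))
          ≡⟨ sum-const p (χ (e - e′)) ⟩
        + p * χ (e - e′)
          ≡⟨ lemma₂ (+ p * χ (e - e′)) ⟩
        1ℤ + 1ℤ * (+ p * χ (e - e′) - 1ℤ)
          ≡⟨ cong (λ x → 1ℤ + x * (+ p * χ (e - e′) - 1ℤ)) (scalarId-refl 1ℤ (suc s)) ⟨
        1ℤ + δ (suc s) (suc s) * (+ p * χ (e - e′) - 1ℤ) ∎
        where
        open ≡-Reasoning
        lemma₁ : ∀ s a e e′ → (s - s) * a - (e′ - e) ≡ e - e′
        lemma₁ = solve-∀
        lemma₂ : ∀ x → x ≡ 1ℤ + 1ℤ * (x - 1ℤ)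
        lemma₂ = solve-∀
      total (no s≢t) = begin
        sumFin (λ a → χ ((⟦ t ⟧ - ⟦ s ⟧) * ⟦ a ⟧ - (e′ - e)))
          ≡⟨ sum-χ-linear (⟦ t ⟧ - ⟦ s ⟧) (e′ - e) (s≢t ∘ sym ∘ ⟦⟧-injective) ⟩
        1ℤ
          ≡⟨ cong (_+_ 1ℤ) (ℤₚ.*-zeroˡ (+ p * χ (e - e′) - 1ℤ)) ⟨
        1ℤ + 0ℤ * (+ p * χ (e - e′) - 1ℤ)
          ≡⟨ cong (λ x → 1ℤ + x * (+ p * χ (e - e′) - 1ℤ)) (scalarId-≢ 1ℤ (s≢t ∘ suc-injective)) ⟨
        1ℤ + δ (suc s) (suc t) * (+ p * χ (e - e′) - 1ℤ) ∎
        where open ≡-Reasoning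

    -- Points with equal first coordinates are joined in direction `zero`. Otherwise the direction
    -- is `suc s`, where `s` is the unique root of `(a′ - a) s ≡ b - b′` modulo `p`.
    joining-line : ∀ {u v} → u ≢ v →
      ∃ λ d₀ → incident d₀ u v ≡ 1ℤ × (∀ d → d ≢ d₀ → incident d u v ≡ 0ℤ)
    joining-line {a , b} {a′ , b′} u≢v with a′ ≟ a
    ... | yes refl = zero , incident-refl zero (a , b) , λ
      { zero    d≢0 → contradiction refl d≢0
      ; (suc s) _   → χ-no λ p∣ → u≢v (cong (a ,_) (sym (⟦⟧-injective (subst (+ p ∣_) (e ⟦ a ⟧ ⟦ b ⟧ ⟦ b′ ⟧ ⟦ s ⟧) p∣)))) }
      where
      e : ∀ a b b′ s → (b′ + s * a) - (b + s * a) ≡ b′ - b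
      e = solve-∀
    ... | no a′≢a with linear-congruence (⟦ a′ ⟧ - ⟦ a ⟧) (⟦ b ⟧ - ⟦ b′ ⟧) (a′≢a ∘ ⟦⟧-injective)
    ...   | s₀ , root , unique = suc s₀ , χ-yes (subst (+ p ∣_) (e ⟦ a ⟧ ⟦ a′ ⟧ ⟦ b ⟧ ⟦ b′ ⟧ ⟦ s₀ ⟧) root) , λ
      { zero    _    → χ-no (a′≢a ∘ ⟦⟧-injective)
      ; (suc s) s≢s₀ → χ-no λ p∣ → s≢s₀ (cong suc
                         (unique s (subst (+ p ∣_) (sym (e ⟦ a ⟧ ⟦ a′ ⟧ ⟦ b ⟧ ⟦ b′ ⟧ ⟦ s ⟧)) p∣))) }
      where
      e : ∀ a a′ b b′ s → (a′ - a) * s - (b - b′) ≡ (b′ + s * a′) - (b + s * a)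
      e = solve-∀

  -- A conference matrix from half of the parallel classes

  module AffineConference {p : ℕ} (p-prime : Prime p) (2∤p : ¬ 2 ℕᵈ.∣ p) where
    open AffinePlane p-prime

    -- After negation the signs of the `p` directions `suc s` sum to `- 1`, which balances direction
    -- `zero`.
    σ : Fin (suc p) → ℤ
    σ zero    = 1ℤ
    σ (suc s) = - alternating s

    σ-sign : ∀ d → IsSign (σ d)
    σ-sign zero    = inj₁ refl
    σ-sign (suc s) = sign-neg (alternating-sign s)

    sum-neg-alternating : sumFin {p} (λ s → - alternating s) ≡ - 1ℤ
    sum-neg-alternating = trans (sum-cong {p} λ s → sym (ℤₚ.-1*i≡-i (alternating s)))
      (trans (sum-*ˡ {p} (- 1ℤ) alternating) (cong (- 1ℤ *_) (sum-alternating p 2∤p)))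

    sum-σ : sumFin σ ≡ 0ℤ
    sum-σ = cong (_+_ 1ℤ) sum-neg-alternating

    -- S u v is the sign of the direction of the line joining u and v; since the signs sum to 0, it vanishes for u ≡ v.
    S : Point → Point → ℤ
    S u v = sumFin (λ d → σ d * incident d u v)

    S-symmetric : ∀ u v → S u v ≡ S v u
    S-symmetric u v = sum-cong λ d → cong (σ d *_) (incident-symmetric d u v)

    S-diagonal : ∀ u → S u u ≡ 0ℤ
    S-diagonal u = trans (sum-cong λ d → trans (cong (σ d *_) (incident-refl d u)) (ℤₚ.*-identityʳ (σ d))) sum-σ

    S-offDiagonal : ∀ {u v} → u ≢ v → IsSign (S u v)
    S-offDiagonal {u} {v} u≢v with joining-line u≢v
    ... | d₀ , on , off = subst IsSign (sym (trans
            (sum-single d₀ λ d d≢d₀ → trans (cong (σ d *_) (off d d≢d₀)) (ℤₚ.*-zeroʳ (σ d)))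
            (trans (cong (σ d₀ *_) on) (ℤₚ.*-identityʳ (σ d₀)))))
          (σ-sign d₀)

    points : ℕ
    points = p ℕ.* p

    pt : Fin points → Point
    pt = remQuot {p} p

    sum-pt : ∀ (f : Point → ℤ) → sumFin (λ w → f (pt w)) ≡ sum-points f
    sum-pt f = sum-remQuot p f

    -- Every line through `u` has `p` points, so the row sum is `p` times the sum of the signs of
    -- the directions, which is zero.
    S-rowSum : ∀ u → sumFin (λ w → S u (pt w)) ≡ 0ℤ
    S-rowSum u = begin
      sumFin (λ w → sumFin (λ d → σ d * incident d u (pt w)))
        ≡⟨ sum-swap (λ w d → σ d * incident d u (pt w)) ⟩
      sumFin (λ d → sumFin (λ w → σ d * incident d u (pt w)))
        ≡⟨ sum-cong (λ d → trans (sum-*ˡ (σ d) (λ w → incident d u (pt w)))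
             (cong (σ d *_) (trans (sum-pt (incident d u)) (line-size d (line d u))))) ⟩
      sumFin (λ d → σ d * + p)
        ≡⟨ trans (sum-*ʳ (+ p) σ) (cong (_* + p) sum-σ) ⟩
      0ℤ ∎
      where open ≡-Reasoning

    sum-incident : ∀ u v → sumFin (λ d → + p * incident d u v - 1ℤ) ≡ + p * sumFin (λ d → incident d u v) - + suc p
    sum-incident u v = begin
      sumFin (λ d → + p * incident d u v - 1ℤ)
        ≡⟨ sum-+ (λ d → + p * incident d u v) (λ _ → - 1ℤ) ⟩
      sumFin (λ d → + p * incident d u v) + sumFin {suc p} (λ _ → - 1ℤ)
        ≡⟨ cong₂ _+_ (sum-*ˡ (+ p) (λ d → incident d u v))
             (trans (sum-const (suc p) (- 1ℤ)) (trans (ℤₚ.*-comm (+ suc p) (- 1ℤ)) (ℤₚ.-1*i≡-i (+ suc p)))) ⟩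
      + p * sumFin (λ d → incident d u v) - + suc p ∎
      where open ≡-Reasoning

    -- Expand over pairs of directions and count common points by `intersection`. Its constant 1
    -- contributes the square of the sum of the signs, which is zero; only equal directions remain,
    -- and there the signs square to 1.
    S-square : ∀ u v → sumFin (λ w → S u (pt w) * S v (pt w)) ≡
      + p * sumFin (λ d → incident d v u) - + suc p
    S-square u v = begin
      sumFin (λ w → S u (pt w) * S v (pt w))
        ≡⟨ sum-product (λ d w → σ d * incident d u (pt w)) (λ d w → σ d * incident d v (pt w)) ⟩
      sumFin (λ d → sumFin (λ d′ → sumFin (λ w → σ d * incident d u (pt w) * (σ d′ * incident d′ v (pt w)))))
        ≡⟨ sum-cong (λ d → sum-cong (λ d′ → pair d d′)) ⟩
      sumFin (λ d → sumFin (λ d′ → σ d * σ d′ + δ d d′ * (σ d * σ d′ * X d d′)))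
        ≡⟨ sum-cong (λ d → trans (sum-+ (λ d′ → σ d * σ d′) (λ d′ → δ d d′ * (σ d * σ d′ * X d d′)))
             (cong₂ _+_ (trans (sum-*ˡ (σ d) σ) (trans (cong (σ d *_) sum-σ) (ℤₚ.*-zeroʳ (σ d))))
               (trans (sum-δˡ d (λ d′ → σ d * σ d′ * X d d′))
                 (trans (cong (_* X d d) (sign-square (σ-sign d))) (ℤₚ.*-identityˡ (X d d)))))) ⟩
      sumFin (λ d → 0ℤ + X d d)
        ≡⟨ sum-cong (λ d → ℤₚ.+-identityˡ (X d d)) ⟩
      sumFin (λ d → + p * incident d v u - 1ℤ)
        ≡⟨ sum-incident v u ⟩
      + p * sumFin (λ d → incident d v u) - + suc p ∎
      where
      open ≡-Reasoning
      X : Fin (suc p) → Fin (suc p) → ℤ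
      X d d′ = + p * χ (line d u - line d′ v) - 1ℤ
      e₁ : ∀ s i t j → s * i * (t * j) ≡ s * t * (i * j)
      e₁ = solve-∀
      e₂ : ∀ s t d x → s * t * (1ℤ + d * x) ≡ s * t + d * (s * t * x)
      e₂ = solve-∀
      pair : ∀ d d′ → sumFin (λ w → σ d * incident d u (pt w) * (σ d′ * incident d′ v (pt w))) ≡
        σ d * σ d′ + δ d d′ * (σ d * σ d′ * X d d′)
      pair d d′ = begin
        sumFin (λ w → σ d * incident d u (pt w) * (σ d′ * incident d′ v (pt w)))
          ≡⟨ sum-cong (λ w → e₁ (σ d) (incident d u (pt w)) (σ d′) (incident d′ v (pt w))) ⟩
        sumFin (λ w → σ d * σ d′ * (incident d u (pt w) * incident d′ v (pt w)))
          ≡⟨ sum-*ˡ (σ d * σ d′) (λ w → incident d u (pt w) * incident d′ v (pt w)) ⟩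
        σ d * σ d′ * sumFin (λ w → incident d u (pt w) * incident d′ v (pt w))
          ≡⟨ cong (σ d * σ d′ *_) (trans (sum-pt (λ w → incident d u w * incident d′ v w))
               (intersection d d′ (line d u) (line d′ v))) ⟩
        σ d * σ d′ * (1ℤ + δ d d′ * X d d′)
          ≡⟨ e₂ (σ d) (σ d′) (δ d d′) (X d d′) ⟩
        σ d * σ d′ + δ d d′ * (σ d * σ d′ * X d d′) ∎

    C : Matrix (suc points)
    C zero    zero    = 0ℤ
    C zero    (suc v) = 1ℤ
    C (suc u) zero    = 1ℤ
    C (suc u) (suc v) = S (pt u) (pt v)

    C-symmetric : IsSymmetric C
    C-symmetric zero    zero    = refl
    C-symmetric zero    (suc v) = refl
    C-symmetric (suc u) zero    = refl
    C-symmetric (suc u) (suc v) = S-symmetric (pt u) (pt v)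

    C-diagonal : ∀ i → C i i ≡ 0ℤ
    C-diagonal zero    = refl
    C-diagonal (suc u) = S-diagonal (pt u)

    C-offDiagonal : ∀ {i j} → i ≢ j → IsSign (C i j)
    C-offDiagonal {zero}  {zero}  i≢j = contradiction refl i≢j
    C-offDiagonal {zero}  {suc v} i≢j = inj₁ refl
    C-offDiagonal {suc u} {zero}  i≢j = inj₁ refl
    C-offDiagonal {suc u} {suc v} i≢j = S-offDiagonal (i≢j ∘ cong suc ∘ remQuot-injective {p} p)

    C-square : ∀ i j → (C ⊗ (C ᵗ)) i j ≡ scalarId (+ p * + p) i j
    C-square zero zero = trans (cong (_+_ 0ℤ) (sum-const points 1ℤ)) (trans (e (+ points)) (ℤₚ.pos-* p p))
      where
      e : ∀ x → 0ℤ + x * 1ℤ ≡ x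
      e = solve-∀
    C-square zero (suc v) = trans (ℤₚ.+-identityˡ _)
      (trans (sum-cong λ w → ℤₚ.*-identityˡ (S (pt v) (pt w))) (S-rowSum (pt v)))
    C-square (suc u) zero = trans (ℤₚ.+-identityˡ _)
      (trans (sum-cong λ w → ℤₚ.*-identityʳ (S (pt u) (pt w))) (S-rowSum (pt u)))
    C-square (suc u) (suc v) = trans (cong (_+_ 1ℤ) (S-square (pt u) (pt v))) (by (u ≟ v))
      where
      by : Dec (u ≡ v) → 1ℤ + (+ p * sumFin (λ d → incident d (pt v) (pt u)) - + suc p) ≡
                         scalarId (+ p * + p) (suc u) (suc v)
      -- With `u ≡ v` all `p + 1` directions are incident, giving `1 + p(p + 1) - (p + 1) = p²`; for
      -- distinct points only the joining direction is, giving `1 + p - (p + 1) = 0`. The leading 1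
      -- comes from the border of `C`.
      by (yes refl) = trans (cong (λ s → 1ℤ + (+ p * s - + suc p))
          (trans (sum-cong λ d → incident-refl d (pt u)) (sum-const (suc p) 1ℤ)))
        (trans (e (+ p)) (sym (scalarId-refl (+ p * + p) (suc u))))
        where
        e : ∀ p → 1ℤ + (p * ((1ℤ + p) * 1ℤ) - (1ℤ + p)) ≡ p * p
        e = solve-∀
      by (no u≢v) with joining-line {pt v} {pt u} (u≢v ∘ sym ∘ remQuot-injective {p} p)
      ... | d₀ , on , off = trans (cong (λ s → 1ℤ + (+ p * s - + suc p)) (trans (sum-single d₀ off) on))
          (trans (e (+ p)) (sym (scalarId-≢ (+ p * + p) (u≢v ∘ suc-injective))))
        where
        e : ∀ p → 1ℤ + (p * 1ℤ - (1ℤ + p)) ≡ 0ℤ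
        e = solve-∀

    ζ : Fin (suc points) → ℤ
    ζ zero    = 1ℤ
    ζ (suc w) = alternating (proj₁ (pt w))

    ζ-sign : ∀ i → IsSign (ζ i)
    ζ-sign zero    = inj₁ refl
    ζ-sign (suc w) = alternating-sign (proj₁ (pt w))

    -- On a line of direction `zero` the first coordinate is constant, so its `p` points contribute
    -- equal signs. Any other line runs once through all first coordinates, over which the
    -- alternating signs sum to 1.
    line-alternating : ∀ u d → sum-points (λ w → incident d u w * alternating (proj₁ w)) ≡
      1ℤ + δ zero d * (+ p * alternating (proj₁ u) - 1ℤ)
    line-alternating (a₀ , b₀) zero = begin
      sumFin (λ a → sumFin {p} (λ b → χ (⟦ a ⟧ - ⟦ a₀ ⟧) * alternating a))
        ≡⟨ sum-cong (λ a → sum-const p (χ (⟦ a ⟧ - ⟦ a₀ ⟧) * alternating a)) ⟩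
      sumFin (λ a → + p * (χ (⟦ a ⟧ - ⟦ a₀ ⟧) * alternating a))
        ≡⟨ sum-*ˡ (+ p) (λ a → χ (⟦ a ⟧ - ⟦ a₀ ⟧) * alternating a) ⟩
      + p * sumFin (λ a → χ (⟦ a ⟧ - ⟦ a₀ ⟧) * alternating a)
        ≡⟨ cong (+ p *_) (sum-residue ⟦ a₀ ⟧ a₀ (divides 0ℤ (ℤₚ.+-inverseʳ ⟦ a₀ ⟧)) alternating) ⟩
      + p * alternating a₀
        ≡⟨ e (+ p * alternating a₀) ⟩
      1ℤ + 1ℤ * (+ p * alternating a₀ - 1ℤ) ∎
      where
      open ≡-Reasoning
      e : ∀ x → x ≡ 1ℤ + 1ℤ * (x - 1ℤ)
      e = solve-∀
    line-alternating (a₀ , b₀) (suc s) = trans (sum-line-function s (line (suc s) (a₀ , b₀)) alternating)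
      (trans (sum-alternating p 2∤p) (e (+ p * alternating a₀ - 1ℤ)))
      where
      e : ∀ x → 1ℤ ≡ 1ℤ + 0ℤ * x
      e = solve-∀

    -- In a row of a point, the constant 1 of `line-alternating` is weighted by signs of sum zero.
    -- Direction `zero`, which has sign 1, leaves `p * ζ i - 1`, and the border entry adds the
    -- missing 1.
    C-eigen : ∀ i → (C · ζ) i ≡ + p * ζ i
    C-eigen zero = begin
      0ℤ + sumFin (λ w → 1ℤ * alternating (proj₁ (pt w)))
        ≡⟨ trans (ℤₚ.+-identityˡ _) (sum-cong λ w → ℤₚ.*-identityˡ (alternating (proj₁ (pt w)))) ⟩
      sumFin (λ w → alternating (proj₁ (pt w)))
        ≡⟨ sum-pt (λ w → alternating (proj₁ w)) ⟩
      sumFin {p} (λ a → sumFin {p} (λ b → alternating a))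
        ≡⟨ trans (sum-cong {p} λ a → sum-const p (alternating a)) (sum-*ˡ {p} (+ p) alternating) ⟩
      + p * sumFin {p} alternating
        ≡⟨ cong (+ p *_) (sum-alternating p 2∤p) ⟩
      + p * 1ℤ ∎
      where open ≡-Reasoning
    C-eigen (suc x) = begin
      1ℤ + sumFin (λ w → S u (pt w) * alternating (proj₁ (pt w)))
        ≡⟨ cong (_+_ 1ℤ) (trans (sum-cong λ w → trans
             (sym (sum-*ʳ (alternating (proj₁ (pt w))) (λ d → σ d * incident d u (pt w))))
             (sum-cong λ d → ℤₚ.*-assoc (σ d) (incident d u (pt w)) (alternating (proj₁ (pt w)))))
           (sum-swap (λ w d → σ d * (incident d u (pt w) * alternating (proj₁ (pt w)))))) ⟩
      1ℤ + sumFin (λ d → sumFin (λ w → σ d * (incident d u (pt w) * alternating (proj₁ (pt w)))))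
        ≡⟨ cong (_+_ 1ℤ) (sum-cong λ d → trans
             (sum-*ˡ (σ d) (λ w → incident d u (pt w) * alternating (proj₁ (pt w))))
             (trans (cong (σ d *_) (trans (sum-pt (λ w → incident d u w * alternating (proj₁ w))) (line-alternating u d)))
                    (e₁ (σ d) (δ zero d) (Y - 1ℤ)))) ⟩
      1ℤ + sumFin (λ d → σ d + δ zero d * (σ d * (Y - 1ℤ)))
        ≡⟨ cong (_+_ 1ℤ) (trans (sum-+ σ (λ d → δ zero d * (σ d * (Y - 1ℤ))))
             (cong₂ _+_ sum-σ (sum-δˡ zero (λ d → σ d * (Y - 1ℤ))))) ⟩
      1ℤ + (0ℤ + 1ℤ * (Y - 1ℤ))
        ≡⟨ e₂ Y ⟩
      Y ∎
      where
      open ≡-Reasoning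
      u : Point
      u = pt x
      Y : ℤ
      Y = + p * alternating (proj₁ u)
      e₁ : ∀ s d y → s * (1ℤ + d * y) ≡ s + d * (s * y)
      e₁ = solve-∀
      e₂ : ∀ y → 1ℤ + (0ℤ + 1ℤ * (y - 1ℤ)) ≡ y
      e₂ = solve-∀

    conference : RegularConference p (suc points)
    conference = record
      { C           = C
      ; symmetric   = C-symmetric
      ; diagonal    = C-diagonal
      ; offDiagonal = C-offDiagonal
      ; square      = C-square
      ; ζ           = ζ
      ; ζ-sign      = ζ-sign
      ; eigen       = C-eigen
      }

  -- Order and excess in terms of the prime

  maximalExcess-prime : ∀ {p} → Prime p → ¬ 2 ℕᵈ.∣ p →
    MaximalExcess (4 ℕ.+ 4 ℕ.* p ℕ.^ 2) (+ (8 ℕ.* p ℕ.* (1 ℕ.+ p ℕ.^ 2)))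
  maximalExcess-prime {suc (suc n)} p-prime 2∤p = subst₂ MaximalExcess order value
    (conference⇒maximalExcess n p-odd conference (cong (_+_ 1ℤ) (ℤₚ.pos-* p p)))
    where
    open AffineConference p-prime 2∤p using (conference)
    p : ℕ
    p = suc (suc n)
    p-odd : Odd (+ p)
    p-odd with parity (+ p)
    ... | inj₁ (w , p≡2w) = contradiction (∣⇒∣ᵤ (divides {+ 2} {+ p} w (trans p≡2w (ℤₚ.*-comm (+ 2) w)))) 2∤p
    ... | inj₂ odd        = odd
    order : 2 ℕ.* (2 ℕ.* (1 ℕ.+ p ℕ.* p)) ≡ 4 ℕ.+ 4 ℕ.* p ℕ.^ 2
    order = trans (sym (ℕₚ.*-assoc 2 2 (1 ℕ.+ p ℕ.* p)))
      -- `p ^ 2` computes to `p * (p * 1)`, so one factor `p` is replaced by `p * 1`.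
      (trans (ℕₚ.*-distribˡ-+ 4 1 (p ℕ.* p)) (cong (λ q → 4 ℕ.+ 4 ℕ.* (p ℕ.* q)) (sym (ℕₚ.*-identityʳ p))))
    value : + 8 * + p * (1ℤ + + p * + p) ≡ + (8 ℕ.* p ℕ.* (1 ℕ.+ p ℕ.^ 2))
    value = begin
      + 8 * + p * (1ℤ + + p * + p)
        ≡⟨ cong₂ (λ s t → s * (1ℤ + t)) (sym (ℤₚ.pos-* 8 p)) (sym (ℤₚ.pos-* p p)) ⟩
      + (8 ℕ.* p) * + (1 ℕ.+ p ℕ.* p)
        ≡⟨ ℤₚ.pos-* (8 ℕ.* p) (1 ℕ.+ p ℕ.* p) ⟨
      + (8 ℕ.* p ℕ.* (1 ℕ.+ p ℕ.* p))
        ≡⟨ cong (λ q → + (8 ℕ.* p ℕ.* (1 ℕ.+ p ℕ.* q))) (sym (ℕₚ.*-identityʳ p)) ⟩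
      + (8 ℕ.* p ℕ.* (1 ℕ.+ p ℕ.^ 2)) ∎
      where open ≡-Reasoning
  maximalExcess-prime {0} (prime {{()}} _)
  maximalExcess-prime {1} (prime {{()}} _)

open import Data.Nat using (ℕ; _+_; _*_; _^_)
open import Data.Nat.Primality using (Prime)
open import Data.Nat.Divisibility using (_∣_)
open import Data.Integer using (+_) renaming (_≤_ to _≤ℤ_)
open import Data.Product using (Σ; _×_)
open import Relation.Nullary using (¬_)
open import Relation.Binary.PropositionalEquality using (_≡_)

theorem5p1 : (p : ℕ) → Prime p → ¬ (2 ∣ p) →
    Σ (Matrix (4 + 4 * p ^ 2)) λ H →
    IsHadamard (4 + 4 * p ^ 2) H ×
    excess H ≡ + (8 * p * (1 + p ^ 2)) ×
    (∀ K → Equivalent (4 + 4 * p ^ 2) K H → excess K ≤ℤ + (8 * p * (1 + p ^ 2)))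
theorem5p1 p p-prime 2∤p = Construction.maximalExcess-prime p-prime 2∤p
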